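{- Let $a,b$ be positive integers and let $n=ab$. Let $\rho'(a,b)$ denote the number of pairs $(x,y)$ of integers such that $x>1$, $y>1$ and $xy\mid ax+by-1$. Then for every integer $n\ge1$ and every real number $\alpha$ with $1\le\alpha\le\sqrt n$, $$\rho'(a,b)<\frac1\alpha\sqrt n\,\log n+2\left(1+\frac{0.6}{\alpha}\right)\sqrt n+\frac{2(2n-1)\alpha}{2\sqrt n-\alpha}.$$
   Context: $\log$ is the natural logarithm. -}

module Defs where

open import Data.Empty using (⊥-elim)
open import Data.Integer.Base as ℤ using (+_; +[1+_]; -[1+_])
import Data.Integer.Properties as ℤ
open import Data.List.Base using (List; length; filter; upTo; cartesianProduct)
open import Data.List.Membership.Propositional using (_∈_)
open import Data.List.Membership.Propositional.Properties
  using (∈-filter⁺; ∈-filter⁻; ∈-cartesianProduct⁺; ∈-upTo⁺)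
open import Data.List.Relation.Unary.Unique.Propositional using (Unique)
import Data.List.Relation.Unary.Unique.Propositional.Properties as Unique
open import Data.Nat.Base as ℕ using (ℕ; zero; suc; NonZero; z≤n; s≤s)
open import Data.Nat.Divisibility using (_∣_; _∣?_; ∣⇒≤; ∣m+n∣m⇒∣n; ∣-trans; m∣m*n; n∣m*n)
import Data.Nat.Properties as ℕ
import Data.Nat.Solver as ℕ-Solver
open import Data.Product using (∃; _×_; _,_; proj₂)
open import Data.Rational.Base as ℚ using (ℚ; 0ℚ; 1ℚ; ½; mkℚ)
import Data.Rational.Properties as ℚ
import Data.Rational.Solver as ℚ-Solver
import Data.Rational.Unnormalised.Base as ℚᵘ
import Data.Rational.Unnormalised.Properties as ℚᵘ
open import Data.Sum using (inj₁; inj₂)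
open import Relation.Binary.PropositionalEquality
  using (_≡_; refl; sym; trans; cong; cong₂; subst; subst₂; module ≡-Reasoning)
open import Relation.Nullary using (Dec; yes; no; contradiction)
open import Relation.Nullary.Decidable using (_×-dec_; from-yes)

-- All of a, b, x, y are positive below, so the truncated subtraction is
-- the integer a x + b y - 1.
Admissible : ℕ → ℕ → ℕ × ℕ → Set
Admissible a b (x , y) =
  1 ℕ.< x × 1 ℕ.< y × x ℕ.* y ∣ a ℕ.* x ℕ.+ b ℕ.* y ℕ.∸ 1

admissible? : ∀ a b xy → Dec (Admissible a b xy)
admissible? a b (x , y) =
  1 ℕ.<? x ×-dec 1 ℕ.<? y ×-dec x ℕ.* y ∣? a ℕ.* x ℕ.+ b ℕ.* y ℕ.∸ 1

-- The search box contains every admissible pair: see ∈-admissiblePairs.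
admissiblePairs : ℕ → ℕ → List (ℕ × ℕ)
admissiblePairs a b = filter (admissible? a b)
  (cartesianProduct (upTo (suc (a ℕ.* b ℕ.+ b))) (upTo (suc (a ℕ.* b ℕ.+ a))))

ρ′ : ℕ → ℕ → ℕ
ρ′ a b = length (admissiblePairs a b)

module _ where
  open import Data.Nat.Base using (_+_; _*_; _∸_; _≤_; _<_)
  open ℕ-Solver.+-*-Solver

  private
    admissible-bound : ∀ a b .{{_ : NonZero a}} .{{_ : NonZero b}} x y →
      1 < x → 1 < y → x * y ∣ a * x + b * y ∸ 1 → x ≤ a * b + b
    admissible-bound a b x y 1<x 1<y xy∣ = by-cases (y ℕ.≤? a)
      where
      1<by : 1 < b * y
      1<by = ℕ.≤-trans 1<y (ℕ.m≤n*m y b)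
      x∣by-1 : x ∣ b * y ∸ 1
      x∣by-1 = ∣m+n∣m⇒∣n
        (subst (x ∣_) (ℕ.+-∸-assoc (a * x) (ℕ.<⇒≤ 1<by)) (∣-trans (m∣m*n y) xy∣))
        (n∣m*n a)
      xy≤ : x * y ≤ a * x + b * y
      xy≤ = ℕ.≤-trans
        (∣⇒≤ {{ℕ.>-nonZero (ℕ.m<n⇒0<n∸m (ℕ.≤-trans 1<by (ℕ.m≤n+m (b * y) (a * x))))}} xy∣)
        (ℕ.m∸n≤m (a * x + b * y) 1)
      aux : ∃ (λ d → suc a + d ≡ y) → x ≤ a * b + b
      aux (d , eq) = ℕ.*-cancelʳ-≤ x (a * b + b) (suc d) (begin
        x * suc d                     ≤⟨ ℕ.+-cancelˡ-≤ (a * x) _ _ (subst₂ _≤_ e₁ e₂ xy≤) ⟩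
        b * (a + suc d)               ≤⟨ ℕ.m≤m+n _ (a * b * d) ⟩
        b * (a + suc d) + a * b * d
          ≡⟨ solve 3 (λ a b d → b :* (a :+ (con 1 :+ d)) :+ a :* b :* d
                               := (a :* b :+ b) :* (con 1 :+ d)) refl a b d ⟩
        (a * b + b) * suc d           ∎)
        where
        open ℕ.≤-Reasoning
        y≡ : y ≡ a + suc d
        y≡ = trans (sym eq) (sym (ℕ.+-suc a d))
        e₁ : x * y ≡ a * x + x * suc d
        e₁ = trans (cong (x *_) y≡) (solve 3 (λ x a d → x :* (a :+ d) := a :* x :+ x :* d) refl x a (suc d))
        e₂ : a * x + b * y ≡ a * x + b * (a + suc d)
        e₂ = cong (λ z → a * x + b * z) y≡

      by-cases : Dec (y ≤ a) → x ≤ a * b + b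
      by-cases (yes y≤a) = ℕ.≤-trans
        (∣⇒≤ {{ℕ.>-nonZero (ℕ.m<n⇒0<n∸m 1<by)}} x∣by-1)
        (ℕ.≤-trans (ℕ.m∸n≤m (b * y) 1)
          (ℕ.≤-trans (subst (b * y ≤_) (ℕ.*-comm b a) (ℕ.*-monoʳ-≤ b y≤a)) (ℕ.m≤m+n _ b)))
      by-cases (no y≰a) = aux (ℕ.m≤n⇒∃[o]m+o≡n (ℕ.≰⇒> y≰a))

  ∈-admissiblePairs : ∀ a b .{{_ : NonZero a}} .{{_ : NonZero b}} xy →
                      Admissible a b xy → xy ∈ admissiblePairs a b
  ∈-admissiblePairs a b (x , y) p@(1<x , 1<y , xy∣) = ∈-filter⁺ (admissible? a b)
    (∈-cartesianProduct⁺
      (∈-upTo⁺ (s≤s (admissible-bound a b x y 1<x 1<y xy∣)))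
      (∈-upTo⁺ (s≤s (subst (λ z → y ≤ z + a) (ℕ.*-comm b a)
        (admissible-bound b a y x 1<y 1<x
          (subst₂ _∣_ (ℕ.*-comm x y) (cong (_∸ 1) (ℕ.+-comm (a * x) (b * y))) xy∣))))))
    p

  admissiblePairs-sound : ∀ a b xy → xy ∈ admissiblePairs a b → Admissible a b xy
  admissiblePairs-sound a b xy xy∈ = proj₂ (∈-filter⁻ (admissible? a b) {xs =
    cartesianProduct (upTo (suc (a * b + b))) (upTo (suc (a * b + a)))} xy∈)

  admissiblePairs-unique : ∀ a b → Unique (admissiblePairs a b)
  admissiblePairs-unique a b = Unique.filter⁺ (admissible? a b)
    (Unique.cartesianProduct⁺ (Unique.upTo⁺ (suc (a * b + b))) (Unique.upTo⁺ (suc (a * b + a))))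

fromℕℚ : ℕ → ℚ
fromℕℚ n = + n ℚ./ 1

1/suc : ℕ → ℚ
1/suc m = + 1 ℚ./ suc m

-- The value at 0 is junk; it affects no limit below, since reciprocals are
-- only taken of sequences that are eventually bounded below by some c > 0.
recip : ℚ → ℚ
recip p with p ℚ.≟ 0ℚ
... | yes _   = 0ℚ
... | no  p≢0 = ℚ.1/_ p {{ℚ.≢-nonZero p≢0}}

module ℚ-Lemmas where
  open import Data.Rational.Base using (_+_; _*_; _-_; -_; _≤_; _<_; ∣_∣)
  open ℚ-Solver.+-*-Solver

  private
    *-difference : ∀ a b c d → a * b - c * d ≡ a * (b - d) + (a - c) * d
    *-difference = solve 4 (λ a b c d → a :* b :- c :* d := a :* (b :- d) :+ (a :- c) :* d) refl

    +-difference : ∀ a b c d → (a + b) - (c + d) ≡ (a - c) + (b - d)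
    +-difference = solve 4 (λ a b c d → (a :+ b) :- (c :+ d) := (a :- c) :+ (b :- d)) refl

    factor : ∀ a b c → a * c + c * b ≡ (a + b) * c
    factor = solve 3 (λ a b c → a :* c :+ c :* b := (a :+ b) :* c) refl

    recip-difference : ∀ a b p q → (a * b) * (q - p) ≡ a * (q * b) - b * (p * a)
    recip-difference = solve 4 (λ a b p q → (a :* b) :* (q :- p) := a :* (q :* b) :- b :* (p :* a)) refl

    regroup : ∀ a b c e → (a * b) * (c * c * e) ≡ (c * a) * (c * b) * e
    regroup = solve 4 (λ a b c e → (a :* b) :* (c :* c :* e) := (c :* a) :* (c :* b) :* e) refl

  neg-difference : ∀ a b → - a - - b ≡ b - a
  neg-difference = solve 2 (λ a b → :- a :- :- b := b :- a) refl

  add-back : ∀ a b → a ≡ (a - b) + b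
  add-back = solve 2 (λ x y → x := (x :- y) :+ y) refl

  *-interchange : ∀ a b c d → (a * b) * (c * d) ≡ (a * c) * (b * d)
  *-interchange = solve 4 (λ a b c d → (a :* b) :* (c :* d) := (a :* c) :* (b :* d)) refl

  *-interchange′ : ∀ a b c d → (a * b) * (c * d) ≡ (a * d) * (b * c)
  *-interchange′ = solve 4 (λ a b c d → (a :* b) :* (c :* d) := (a :* d) :* (b :* c)) refl

  distrib-middle : ∀ a b c d → (a + b) * (c * d) ≡ (a * c + b * c) * d
  distrib-middle = solve 4 (λ a b c d → (a :+ b) :* (c :* d) := (a :* c :+ b :* c) :* d) refl

  double-minus : ∀ x s c → (s + c) + s ≡ (x + c) + ((s + s) - x)
  double-minus = solve 3 (λ x s c → (s :+ c) :+ s := (x :+ c) :+ ((s :+ s) :- x)) refl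

  *-monoˡ : ∀ r {p q} → 0ℚ ≤ r → p ≤ q → r * p ≤ r * q
  *-monoˡ r 0≤r = ℚ.*-monoˡ-≤-nonNeg r {{ℚ.nonNegative 0≤r}}

  *-monoʳ : ∀ r {p q} → 0ℚ ≤ r → p ≤ q → p * r ≤ q * r
  *-monoʳ r 0≤r = ℚ.*-monoʳ-≤-nonNeg r {{ℚ.nonNegative 0≤r}}

  *-mono : ∀ {p q r s} → 0ℚ ≤ r → 0ℚ ≤ q → p ≤ q → r ≤ s → p * r ≤ q * s
  *-mono {p} {q} {r} {s} 0≤r 0≤q p≤q r≤s = ℚ.≤-trans (*-monoʳ r 0≤r p≤q) (*-monoˡ q 0≤q r≤s)

  0≤* : ∀ {p q} → 0ℚ ≤ p → 0ℚ ≤ q → 0ℚ ≤ p * q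
  0≤* {p} {q} 0≤p 0≤q = subst (_≤ p * q) (ℚ.*-zeroʳ p) (*-monoˡ p 0≤p 0≤q)

  0<* : ∀ {p q} → 0ℚ < p → 0ℚ < q → 0ℚ < p * q
  0<* {p} {q} 0<p 0<q = subst (_< p * q) (ℚ.*-zeroʳ p) (ℚ.*-monoʳ-<-pos p {{ℚ.positive 0<p}} 0<q)

  0<+ : ∀ {p q} → 0ℚ < p → 0ℚ ≤ q → 0ℚ < p + q
  0<+ 0<p 0≤q = ℚ.+-mono-<-≤ 0<p 0≤q

  ≤-+ʳ : ∀ p {q} → 0ℚ ≤ q → p ≤ p + q
  ≤-+ʳ p {q} 0≤q = subst (_≤ p + q) (ℚ.+-identityʳ p) (ℚ.+-monoʳ-≤ p 0≤q)

  +-cancelˡ-≤ : ∀ r {p q} → r + p ≤ r + q → p ≤ q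
  +-cancelˡ-≤ r {p} {q} h = subst₂ _≤_ (e p) (e q) (ℚ.+-monoʳ-≤ (- r) h)
    where
    e : ∀ p → - r + (r + p) ≡ p
    e p = solve 2 (λ r p → :- r :+ (r :+ p) := p) refl r p

  ≤-swap : ∀ {p q r} → p ≤ q + r → p - q ≤ r
  ≤-swap {p} {q} {r} h = subst (p - q ≤_)
    (solve 2 (λ q r → (q :+ r) :- q := r) refl q r) (ℚ.+-monoˡ-≤ (- q) h)

  ∣∣-swap : ∀ p q → ∣ p - q ∣ ≡ ∣ q - p ∣
  ∣∣-swap p q = trans (sym (ℚ.∣-p∣≡∣p∣ (p - q)))
    (cong ∣_∣ (solve 2 (λ p q → :- (p :- q) := q :- p) refl p q))

  ∣∣-≤ : ∀ {p r} → p ≤ r → - p ≤ r → ∣ p ∣ ≤ r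
  ∣∣-≤ {p} h₁ h₂ with ℚ.∣p∣≡p∨∣p∣≡-p p
  ... | inj₁ e = subst (_≤ _) (sym e) h₁
  ... | inj₂ e = subst (_≤ _) (sym e) h₂

  ∣p-q∣≤ : ∀ {p q r} → p ≤ q + r → q ≤ p + r → ∣ p - q ∣ ≤ r
  ∣p-q∣≤ {p} {q} {r} h₁ h₂ = ∣∣-≤ (≤-swap h₁)
    (subst (_≤ r) (solve 2 (λ p q → q :- p := :- (p :- q)) refl p q) (≤-swap h₂))

  half+half : ∀ p → ½ * p + ½ * p ≡ p
  half+half p = trans (sym (ℚ.*-distribʳ-+ p ½ ½)) (ℚ.*-identityˡ p)

  0<½ : 0ℚ < ½
  0<½ = from-yes (0ℚ ℚ.<? ½)

  +-close : ∀ {a b c d ε} → ∣ a - c ∣ ≤ ½ * ε → ∣ b - d ∣ ≤ ½ * ε →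
            ∣ (a + b) - (c + d) ∣ ≤ ε
  +-close {a} {b} {c} {d} {ε} h₁ h₂ = begin
    ∣ (a + b) - (c + d) ∣      ≡⟨ cong ∣_∣ (+-difference a b c d) ⟩
    ∣ (a - c) + (b - d) ∣      ≤⟨ ℚ.∣p+q∣≤∣p∣+∣q∣ (a - c) (b - d) ⟩
    ∣ a - c ∣ + ∣ b - d ∣      ≤⟨ ℚ.+-mono-≤ h₁ h₂ ⟩
    ½ * ε + ½ * ε              ≡⟨ half+half ε ⟩
    ε                          ∎
    where open ℚ.≤-Reasoning

  *-close : ∀ {a b c d A B δ} → 0ℚ ≤ A → 0ℚ ≤ δ → ∣ a ∣ ≤ A → ∣ d ∣ ≤ B →
            ∣ a - c ∣ ≤ δ → ∣ b - d ∣ ≤ δ → ∣ a * b - c * d ∣ ≤ (A + B) * δ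
  *-close {a} {b} {c} {d} {A} {B} {δ} 0≤A 0≤δ a≤A d≤B h₁ h₂ = begin
    ∣ a * b - c * d ∣                          ≡⟨ cong ∣_∣ (*-difference a b c d) ⟩
    ∣ a * (b - d) + (a - c) * d ∣              ≤⟨ ℚ.∣p+q∣≤∣p∣+∣q∣ (a * (b - d)) ((a - c) * d) ⟩
    ∣ a * (b - d) ∣ + ∣ (a - c) * d ∣          ≡⟨ cong₂ _+_ (ℚ.∣p*q∣≡∣p∣*∣q∣ a (b - d)) (ℚ.∣p*q∣≡∣p∣*∣q∣ (a - c) d) ⟩
    ∣ a ∣ * ∣ b - d ∣ + ∣ a - c ∣ * ∣ d ∣      ≤⟨ ℚ.+-mono-≤ (*-mono (ℚ.0≤∣p∣ (b - d)) 0≤A a≤A h₂)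
                                                             (*-mono (ℚ.0≤∣p∣ d) 0≤δ h₁ d≤B) ⟩
    A * δ + δ * B                              ≡⟨ factor A B δ ⟩
    (A + B) * δ                                ∎
    where open ℚ.≤-Reasoning

  recip-inverse : ∀ {p} → 0ℚ < p → p * recip p ≡ 1ℚ
  recip-inverse {p} 0<p with p ℚ.≟ 0ℚ
  ... | yes p≡0 = contradiction 0<p (ℚ.<-irrefl (sym p≡0))
  ... | no  p≢0 = ℚ.*-inverseʳ p {{ℚ.≢-nonZero p≢0}}

  inverse-unique : ∀ {p q r} → p * q ≡ 1ℚ → p * r ≡ 1ℚ → q ≡ r
  inverse-unique {p} {q} {r} pq pr = begin
    q            ≡⟨ ℚ.*-identityʳ q ⟨
    q * 1ℚ       ≡⟨ cong (q *_) pr ⟨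
    q * (p * r)  ≡⟨ solve 3 (λ p q r → q :* (p :* r) := (p :* q) :* r) refl p q r ⟩
    (p * q) * r  ≡⟨ cong (_* r) pq ⟩
    1ℚ * r       ≡⟨ ℚ.*-identityˡ r ⟩
    r            ∎
    where open ≡-Reasoning

  0<recip : ∀ {p} → 0ℚ < p → 0ℚ < recip p
  0<recip {p} 0<p with recip p ℚ.≤? 0ℚ
  ... | no  r≰0 = ℚ.≰⇒> r≰0
  ... | yes r≤0 = ⊥-elim (ℚ.<-irrefl refl (ℚ.<-≤-trans (from-yes (0ℚ ℚ.<? 1ℚ))
    (subst₂ _≤_ (recip-inverse 0<p) (ℚ.*-zeroʳ p) (*-monoˡ p (ℚ.<⇒≤ 0<p) r≤0))))

  recip-close : ∀ {c p q ε} → 0ℚ < c → c ≤ p → c ≤ q → 0ℚ ≤ ε →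
                ∣ p - q ∣ ≤ c * c * ε → ∣ recip p - recip q ∣ ≤ ε
  recip-close {c} {p} {q} {ε} 0<c c≤p c≤q 0≤ε h = begin
    ∣ rp - rq ∣                ≡⟨ cong ∣_∣ e ⟩
    ∣ (rp * rq) * (q - p) ∣    ≡⟨ ℚ.∣p*q∣≡∣p∣*∣q∣ (rp * rq) (q - p) ⟩
    ∣ rp * rq ∣ * ∣ q - p ∣    ≡⟨ cong₂ _*_ (ℚ.0≤p⇒∣p∣≡p 0≤rr) (∣∣-swap q p) ⟩
    (rp * rq) * ∣ p - q ∣      ≤⟨ *-monoˡ (rp * rq) 0≤rr h ⟩
    (rp * rq) * (c * c * ε)
      ≡⟨ regroup rp rq c ε ⟩
    (c * rp) * (c * rq) * ε    ≤⟨ *-monoʳ ε 0≤ε (*-mono (0≤* 0≤c 0≤rq) (from-yes (0ℚ ℚ.≤? 1ℚ)) (c*r≤1 0<p c≤p) (c*r≤1 0<q c≤q)) ⟩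
    1ℚ * 1ℚ * ε                ≡⟨ trans (cong (_* ε) (ℚ.*-identityˡ 1ℚ)) (ℚ.*-identityˡ ε) ⟩
    ε                          ∎
    where
    open ℚ.≤-Reasoning
    rp rq : ℚ
    rp = recip p
    rq = recip q
    0≤c : 0ℚ ≤ c
    0≤c = ℚ.<⇒≤ 0<c
    0<p : 0ℚ < p
    0<p = ℚ.<-≤-trans 0<c c≤p
    0<q : 0ℚ < q
    0<q = ℚ.<-≤-trans 0<c c≤q
    0≤rp : 0ℚ ≤ rp
    0≤rp = ℚ.<⇒≤ (0<recip 0<p)
    0≤rq : 0ℚ ≤ rq
    0≤rq = ℚ.<⇒≤ (0<recip 0<q)
    0≤rr : 0ℚ ≤ rp * rq
    0≤rr = 0≤* 0≤rp 0≤rq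
    c*r≤1 : ∀ {x} → 0ℚ < x → c ≤ x → c * recip x ≤ 1ℚ
    c*r≤1 {x} 0<x c≤x = subst (c * recip x ≤_) (recip-inverse 0<x)
      (*-monoʳ (recip x) (ℚ.<⇒≤ (0<recip 0<x)) c≤x)
    e : rp - rq ≡ (rp * rq) * (q - p)
    e = sym (begin-equality
      (rp * rq) * (q - p)
        ≡⟨ recip-difference rp rq p q ⟩
      rp * (q * rq) - rq * (p * rp)
        ≡⟨ cong₂ (λ u v → rp * u - rq * v) (recip-inverse 0<q) (recip-inverse 0<p) ⟩
      rp * 1ℚ - rq * 1ℚ
        ≡⟨ cong₂ _-_ (ℚ.*-identityʳ rp) (ℚ.*-identityʳ rq) ⟩
      rp - rq ∎)

  private
    toℚᵘ-/ : ∀ k m → ℚ.toℚᵘ (k ℚ./ suc m) ℚᵘ.≃ ℚᵘ.mkℚᵘ k m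
    toℚᵘ-/ k m = ℚ.toℚᵘ-fromℚᵘ (ℚᵘ.mkℚᵘ k m)

  /-mono : ∀ i j m n → i ℤ.* + suc n ℤ.≤ j ℤ.* + suc m → i ℚ./ suc m ≤ j ℚ./ suc n
  /-mono i j m n h = ℚ.toℚᵘ-cancel-≤ (begin
    ℚ.toℚᵘ (i ℚ./ suc m)  ≃⟨ toℚᵘ-/ i m ⟩
    ℚᵘ.mkℚᵘ i m           ≤⟨ ℚᵘ.*≤* h ⟩
    ℚᵘ.mkℚᵘ j n           ≃⟨ toℚᵘ-/ j n ⟨
    ℚ.toℚᵘ (j ℚ./ suc n)  ∎)
    where open ℚᵘ.≤-Reasoning

  fromℕℚ-+ : ∀ m n → fromℕℚ (m ℕ.+ n) ≡ fromℕℚ m + fromℕℚ n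
  fromℕℚ-+ m n = ℚ.toℚᵘ-injective (begin
    ℚ.toℚᵘ (fromℕℚ (m ℕ.+ n))                   ≈⟨ toℚᵘ-/ (+ (m ℕ.+ n)) 0 ⟩
    ℚᵘ.mkℚᵘ (+ (m ℕ.+ n)) 0                     ≈⟨ ℚᵘ.*≡* (cong (ℤ._* + 1) (cong₂ ℤ._+_ (sym (ℤ.*-identityʳ (+ m))) (sym (ℤ.*-identityʳ (+ n))))) ⟩
    ℚᵘ.mkℚᵘ (+ m) 0 ℚᵘ.+ ℚᵘ.mkℚᵘ (+ n) 0        ≈⟨ ℚᵘ.+-cong (toℚᵘ-/ (+ m) 0) (toℚᵘ-/ (+ n) 0) ⟨
    ℚ.toℚᵘ (fromℕℚ m) ℚᵘ.+ ℚ.toℚᵘ (fromℕℚ n)    ≈⟨ ℚ.toℚᵘ-homo-+ (fromℕℚ m) (fromℕℚ n) ⟨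
    ℚ.toℚᵘ (fromℕℚ m + fromℕℚ n)                ∎)
    where open import Relation.Binary.Reasoning.Setoid ℚᵘ.≃-setoid

  fromℕℚ-* : ∀ m n → fromℕℚ (m ℕ.* n) ≡ fromℕℚ m * fromℕℚ n
  fromℕℚ-* m n = ℚ.toℚᵘ-injective (begin
    ℚ.toℚᵘ (fromℕℚ (m ℕ.* n))                   ≈⟨ toℚᵘ-/ (+ (m ℕ.* n)) 0 ⟩
    ℚᵘ.mkℚᵘ (+ (m ℕ.* n)) 0                     ≈⟨ ℚᵘ.*≡* (cong (ℤ._* + 1) (ℤ.pos-* m n)) ⟩
    ℚᵘ.mkℚᵘ (+ m) 0 ℚᵘ.* ℚᵘ.mkℚᵘ (+ n) 0        ≈⟨ ℚᵘ.*-cong (toℚᵘ-/ (+ m) 0) (toℚᵘ-/ (+ n) 0) ⟨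
    ℚ.toℚᵘ (fromℕℚ m) ℚᵘ.* ℚ.toℚᵘ (fromℕℚ n)    ≈⟨ ℚ.toℚᵘ-homo-* (fromℕℚ m) (fromℕℚ n) ⟨
    ℚ.toℚᵘ (fromℕℚ m * fromℕℚ n)                ∎)
    where open import Relation.Binary.Reasoning.Setoid ℚᵘ.≃-setoid

  fromℕℚ-mono : ∀ {m n} → m ℕ.≤ n → fromℕℚ m ≤ fromℕℚ n
  fromℕℚ-mono {m} {n} m≤n = /-mono (+ m) (+ n) 0 0 (ℤ.*-monoʳ-≤-nonNeg (+ 1) (ℤ.+≤+ m≤n))

  0≤fromℕℚ : ∀ n → 0ℚ ≤ fromℕℚ n
  0≤fromℕℚ n = fromℕℚ-mono {0} {n} z≤n

  1/suc-inverse : ∀ m → fromℕℚ (suc m) * 1/suc m ≡ 1ℚ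
  1/suc-inverse m = ℚ.toℚᵘ-injective (begin
    ℚ.toℚᵘ (fromℕℚ (suc m) * 1/suc m)              ≈⟨ ℚ.toℚᵘ-homo-* (fromℕℚ (suc m)) (1/suc m) ⟩
    ℚ.toℚᵘ (fromℕℚ (suc m)) ℚᵘ.* ℚ.toℚᵘ (1/suc m)  ≈⟨ ℚᵘ.*-cong (toℚᵘ-/ (+ suc m) 0) (toℚᵘ-/ (+ 1) m) ⟩
    ℚᵘ.mkℚᵘ (+ suc m) 0 ℚᵘ.* ℚᵘ.mkℚᵘ (+ 1) m       ≈⟨ ℚᵘ.*≡* (cong +_ (solveℕ m)) ⟩
    ℚ.toℚᵘ 1ℚ                                      ∎)
    where
    open import Relation.Binary.Reasoning.Setoid ℚᵘ.≃-setoid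
    solveℕ : ∀ m → (suc m ℕ.* 1) ℕ.* 1 ≡ 1 ℕ.* (1 ℕ.* suc m)
    solveℕ m = trans (ℕ.*-identityʳ _) (trans (ℕ.*-identityʳ _)
      (sym (trans (ℕ.*-identityˡ _) (ℕ.*-identityˡ _))))

  1/suc-antitone : ∀ {m n} → m ℕ.≤ n → 1/suc n ≤ 1/suc m
  1/suc-antitone {m} {n} m≤n = /-mono (+ 1) (+ 1) n m (ℤ.*-monoˡ-≤-nonNeg (+ 1) (ℤ.+≤+ (s≤s m≤n)))

  0<1/suc : ∀ m → 0ℚ < 1/suc m
  0<1/suc m = ℚ.positive⁻¹ (1/suc m) {{ℚ.normalize-pos 1 (suc m)}}

  0≤1/suc : ∀ m → 0ℚ ≤ 1/suc m
  0≤1/suc m = ℚ.<⇒≤ (0<1/suc m)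

  archimedean : ∀ ε → 0ℚ < ε → ∃ λ N → 1/suc N ≤ ε
  archimedean ε@(mkℚ +[1+ k ] d _) _ = d , ℚ.toℚᵘ-cancel-≤ (begin
    ℚ.toℚᵘ (1/suc d)       ≃⟨ toℚᵘ-/ (+ 1) d ⟩
    ℚᵘ.mkℚᵘ (+ 1) d        ≤⟨ ℚᵘ.*≤* (ℤ.*-monoʳ-≤-nonNeg (+ suc d) {+ 1} {+[1+ k ]} (ℤ.+≤+ (s≤s z≤n))) ⟩
    ℚᵘ.mkℚᵘ +[1+ k ] d     ∎)
    where open ℚᵘ.≤-Reasoning
  archimedean (mkℚ (+ 0) d _) 0<ε = contradiction (ℚ.positive 0<ε) λ ()
  archimedean (mkℚ -[1+ k ] d _) 0<ε = contradiction (ℚ.positive 0<ε) λ ()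

  1/suc-* : ∀ m n k → suc k ≡ suc m ℕ.* suc n → 1/suc m * 1/suc n ≡ 1/suc k
  1/suc-* m n k eq = inverse-unique {fromℕℚ (suc k)}
    (begin
      fromℕℚ (suc k) * (1/suc m * 1/suc n)
        ≡⟨ cong (_* (1/suc m * 1/suc n)) (trans (cong fromℕℚ eq) (fromℕℚ-* (suc m) (suc n))) ⟩
      (fromℕℚ (suc m) * fromℕℚ (suc n)) * (1/suc m * 1/suc n)
        ≡⟨ *-interchange (fromℕℚ (suc m)) (fromℕℚ (suc n)) (1/suc m) (1/suc n) ⟩
      (fromℕℚ (suc m) * 1/suc m) * (fromℕℚ (suc n) * 1/suc n)
        ≡⟨ cong₂ _*_ (1/suc-inverse m) (1/suc-inverse n) ⟩
      1ℚ * 1ℚ ≡⟨ ℚ.*-identityˡ 1ℚ ⟩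
      1ℚ ∎)
    (1/suc-inverse k)
    where open ≡-Reasoning

open ℚ-Lemmas

⌊√_⌋ : ℕ → ℕ
⌊√ zero ⌋  = 0
⌊√ suc N ⌋ with suc ⌊√ N ⌋ ℕ.* suc ⌊√ N ⌋ ℕ.≤? suc N
... | yes _ = suc ⌊√ N ⌋
... | no  _ = ⌊√ N ⌋

module _ where
  open import Data.Nat.Base using (_*_; _+_; _≤_; _<_)

  ⌊√⌋-lower : ∀ N → ⌊√ N ⌋ * ⌊√ N ⌋ ≤ N
  ⌊√⌋-lower zero = z≤n
  ⌊√⌋-lower (suc N) with suc ⌊√ N ⌋ * suc ⌊√ N ⌋ ℕ.≤? suc N
  ... | yes h = h
  ... | no  _ = ℕ.m≤n⇒m≤1+n (⌊√⌋-lower N)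

  ⌊√⌋-upper : ∀ N → N < suc ⌊√ N ⌋ * suc ⌊√ N ⌋
  ⌊√⌋-upper zero = s≤s z≤n
  ⌊√⌋-upper (suc N) with suc ⌊√ N ⌋ * suc ⌊√ N ⌋ ℕ.≤? suc N
  ... | yes _ = ℕ.≤-<-trans (⌊√⌋-upper N) (ℕ.*-mono-< (ℕ.n<1+n (suc ⌊√ N ⌋)) (ℕ.n<1+n (suc ⌊√ N ⌋)))
  ... | no  h = ℕ.≰⇒> h

  square-cancel-≤ : ∀ p q → p * p ≤ q * q → p ≤ q
  square-cancel-≤ p q h with p ℕ.≤? q
  ... | yes p≤q = p≤q
  ... | no  p≰q = contradiction (ℕ.*-mono-< (ℕ.≰⇒> p≰q) (ℕ.≰⇒> p≰q)) (ℕ.≤⇒≯ h)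

√-approx : ℕ → ℕ → ℚ
√-approx n m = fromℕℚ ⌊√ n ℕ.* (suc m ℕ.* suc m) ⌋ ℚ.* 1/suc m

√-approx-rate : ∀ n m k → √-approx n m ℚ.≤ √-approx n k ℚ.+ 1/suc k
√-approx-rate n m k = begin
  A ℚ.* h                           ≡⟨ ℚ.*-identityʳ (A ℚ.* h) ⟨
  A ℚ.* h ℚ.* 1ℚ                    ≡⟨ cong ((A ℚ.* h) ℚ.*_) (1/suc-inverse k) ⟨
  A ℚ.* h ℚ.* (K ℚ.* g)             ≡⟨ *-interchange A h K g ⟩
  (A ℚ.* K) ℚ.* (h ℚ.* g)           ≤⟨ *-monoʳ (h ℚ.* g) (0≤* (0≤1/suc m) (0≤1/suc k)) AK≤ ⟩
  ((B ℚ.+ 1ℚ) ℚ.* M) ℚ.* (h ℚ.* g)  ≡⟨ *-interchange′ (B ℚ.+ 1ℚ) M h g ⟩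
  (B ℚ.+ 1ℚ) ℚ.* g ℚ.* (M ℚ.* h)    ≡⟨ cong (((B ℚ.+ 1ℚ) ℚ.* g) ℚ.*_) (1/suc-inverse m) ⟩
  (B ℚ.+ 1ℚ) ℚ.* g ℚ.* 1ℚ           ≡⟨ ℚ.*-identityʳ _ ⟩
  (B ℚ.+ 1ℚ) ℚ.* g                  ≡⟨ ℚ.*-distribʳ-+ g B 1ℚ ⟩
  B ℚ.* g ℚ.+ 1ℚ ℚ.* g              ≡⟨ cong ((B ℚ.* g) ℚ.+_) (ℚ.*-identityˡ g) ⟩
  B ℚ.* g ℚ.+ g                     ∎
  where
  open ℚ.≤-Reasoning
  open ℚ-Solver.+-*-Solver
  r : ℕ → ℕ
  r m = ⌊√ n ℕ.* (suc m ℕ.* suc m) ⌋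
  A B h g M K : ℚ
  A = fromℕℚ (r m)
  B = fromℕℚ (r k)
  h = 1/suc m
  g = 1/suc k
  M = fromℕℚ (suc m)
  K = fromℕℚ (suc k)
  nat : r m ℕ.* suc k ℕ.≤ suc (r k) ℕ.* suc m
  nat = square-cancel-≤ _ _ (ℕ.≤-trans (ℕ.≤-reflexive (swap (r m) (suc k)))
    (ℕ.≤-trans (ℕ.*-monoˡ-≤ (suc k ℕ.* suc k) (⌊√⌋-lower (n ℕ.* (suc m ℕ.* suc m))))
    (ℕ.≤-trans (ℕ.≤-reflexive (rearrange n (suc m ℕ.* suc m) (suc k ℕ.* suc k)))
    (ℕ.≤-trans (ℕ.*-monoˡ-≤ (suc m ℕ.* suc m) (ℕ.<⇒≤ (⌊√⌋-upper (n ℕ.* (suc k ℕ.* suc k)))))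
      (ℕ.≤-reflexive (sym (swap (suc (r k)) (suc m))))))))
    where
    open ℕ-Solver.+-*-Solver using () renaming (solve to solveℕ; _:*_ to _⊗_; _:=_ to _⊜_)
    swap : ∀ p q → (p ℕ.* q) ℕ.* (p ℕ.* q) ≡ (p ℕ.* p) ℕ.* (q ℕ.* q)
    swap = solveℕ 2 (λ p q → (p ⊗ q) ⊗ (p ⊗ q) ⊜ (p ⊗ p) ⊗ (q ⊗ q)) refl
    rearrange : ∀ p q s → (p ℕ.* q) ℕ.* s ≡ (p ℕ.* s) ℕ.* q
    rearrange = solveℕ 3 (λ p q s → (p ⊗ q) ⊗ s ⊜ (p ⊗ s) ⊗ q) refl
  AK≤ : A ℚ.* K ℚ.≤ (B ℚ.+ 1ℚ) ℚ.* M
  AK≤ = subst₂ ℚ._≤_ (fromℕℚ-* (r m) (suc k))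
    (trans (fromℕℚ-* (suc (r k)) (suc m))
      (cong (ℚ._* M) (trans (cong fromℕℚ (ℕ.+-comm 1 (r k))) (fromℕℚ-+ (r k) 1))))
    (fromℕℚ-mono nat)

-- rightSum f a h N is the right Riemann sum of f on [a, a + N h] with
-- mesh h, that is Σ_{j=1}^{N} h f(a + j h).
rightSum : (ℚ → ℚ) → ℚ → ℚ → ℕ → ℚ
rightSum f a h zero    = 0ℚ
rightSum f a h (suc N) = rightSum f a h N ℚ.+ h ℚ.* f (a ℚ.+ fromℕℚ (suc N) ℚ.* h)

-- The right Riemann sum of 1/t on [1, n] with mesh 1/(m+1).
log-approx : ℕ → ℕ → ℚ
log-approx n m = rightSum recip 1ℚ (1/suc m) ((n ℕ.∸ 1) ℕ.* suc m)

-- harmonicSum m N = Σ_{j=0}^{N-1} 1/(m+1+j)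
harmonicSum : ℕ → ℕ → ℚ
harmonicSum m zero    = 0ℚ
harmonicSum m (suc N) = harmonicSum m N ℚ.+ 1/suc (m ℕ.+ N)

module LogLemmas where
  open import Data.Rational.Base using (_+_; _*_; _≤_)
  open ℚ-Solver.+-*-Solver
  private
    H : ℕ → ℕ → ℚ
    H = harmonicSum

  rightSum≡harmonicSum : ∀ m N → rightSum recip 1ℚ (1/suc m) N ≡ harmonicSum (suc m) N
  rightSum≡harmonicSum m zero    = refl
  rightSum≡harmonicSum m (suc N) = cong₂ _+_ (rightSum≡harmonicSum m N)
    (trans (term (suc N)) (cong 1/suc (ℕ.+-suc m N)))
    where
    open ≡-Reasoning
    h M : ℚ
    h = 1/suc m
    M = fromℕℚ (suc m)
    term : ∀ j → h * recip (1ℚ + fromℕℚ j * h) ≡ 1/suc (m ℕ.+ j)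
    term j = inverse-unique {fromℕℚ (suc (m ℕ.+ j))} (begin
      fromℕℚ (suc m ℕ.+ j) * (h * recip q)  ≡⟨ cong (_* (h * recip q)) (fromℕℚ-+ (suc m) j) ⟩
      (M + J) * (h * recip q)               ≡⟨ distrib-middle M J h (recip q) ⟩
      (M * h + J * h) * recip q             ≡⟨ cong (λ z → (z + J * h) * recip q) (1/suc-inverse m) ⟩
      q * recip q                           ≡⟨ recip-inverse 0<q ⟩
      1ℚ                                    ∎)
      (1/suc-inverse (m ℕ.+ j))
      where
      J q : ℚ
      J = fromℕℚ j
      q = 1ℚ + J * h
      0<q : 0ℚ ℚ.< q
      0<q = 0<+ (from-yes (0ℚ ℚ.<? 1ℚ)) (0≤* (0≤fromℕℚ j) (0≤1/suc m))

  head : ∀ m N → H m (suc N) ≡ 1/suc m + H (suc m) N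
  head m zero    = trans (cong (λ z → 0ℚ + 1/suc z) (ℕ.+-identityʳ m)) (ℚ.+-comm 0ℚ (1/suc m))
  head m (suc N) = begin
    H m (suc N) + 1/suc (m ℕ.+ suc N)                ≡⟨ cong₂ _+_ (head m N) (cong 1/suc (ℕ.+-suc m N)) ⟩
    (1/suc m + H (suc m) N) + 1/suc (suc m ℕ.+ N)    ≡⟨ ℚ.+-assoc (1/suc m) _ _ ⟩
    1/suc m + H (suc m) (suc N)                      ∎
    where open ≡-Reasoning

  split : ∀ m i j → H m (i ℕ.+ j) ≡ H m i + H (m ℕ.+ i) j
  split m i zero    = trans (cong (H m) (ℕ.+-identityʳ i)) (sym (ℚ.+-identityʳ _))
  split m i (suc j) = begin
    H m (i ℕ.+ suc j)                                      ≡⟨ cong (H m) (ℕ.+-suc i j) ⟩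
    H m (i ℕ.+ j) + 1/suc (m ℕ.+ (i ℕ.+ j))                ≡⟨ cong₂ _+_ (split m i j) (cong 1/suc (sym (ℕ.+-assoc m i j))) ⟩
    (H m i + H (m ℕ.+ i) j) + 1/suc (m ℕ.+ i ℕ.+ j)        ≡⟨ ℚ.+-assoc (H m i) _ _ ⟩
    H m i + H (m ℕ.+ i) (suc j)                            ∎
    where open ≡-Reasoning

  suc-* : ∀ N q → fromℕℚ (suc N) * q ≡ fromℕℚ N * q + q
  suc-* N q = begin
    fromℕℚ (suc N) * q            ≡⟨ cong (λ z → fromℕℚ z * q) (ℕ.+-comm 1 N) ⟩
    fromℕℚ (N ℕ.+ 1) * q          ≡⟨ cong (_* q) (fromℕℚ-+ N 1) ⟩
    (fromℕℚ N + 1ℚ) * q           ≡⟨ ℚ.*-distribʳ-+ q (fromℕℚ N) 1ℚ ⟩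
    fromℕℚ N * q + 1ℚ * q         ≡⟨ cong (λ z → fromℕℚ N * q + z) (ℚ.*-identityˡ q) ⟩
    fromℕℚ N * q + q              ∎
    where open ≡-Reasoning

  upper : ∀ m N → H m N ≤ fromℕℚ N * 1/suc m
  upper m zero    = ℚ.≤-reflexive (sym (ℚ.*-zeroˡ (1/suc m)))
  upper m (suc N) = subst (H m (suc N) ≤_) (sym (suc-* N (1/suc m)))
    (ℚ.+-mono-≤ (upper m N) (1/suc-antitone (ℕ.m≤m+n m N)))

  lower : ∀ m N k → m ℕ.+ N ℕ.≤ suc k → fromℕℚ N * 1/suc k ≤ H m N
  lower m zero    k _ = ℚ.≤-reflexive (ℚ.*-zeroˡ (1/suc k))
  lower m (suc N) k h = subst (_≤ H m (suc N)) (sym (suc-* N (1/suc k)))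
    (ℚ.+-mono-≤ (lower m N k (ℕ.≤-trans (ℕ.n≤1+n _) (ℕ.s≤s h′))) (1/suc-antitone h′))
    where
    h′ : m ℕ.+ N ℕ.≤ k
    h′ = ℕ.≤-pred (subst (ℕ._≤ suc k) (ℕ.+-suc m N) h)

  step-suc : ∀ p m k → suc k ≡ suc p ℕ.* suc m → fromℕℚ (suc p) * 1/suc k ≡ 1/suc m
  step-suc p m k eq = begin
    fromℕℚ (suc p) * 1/suc k                  ≡⟨ cong (fromℕℚ (suc p) *_) (1/suc-* p m k eq) ⟨
    fromℕℚ (suc p) * (1/suc p * 1/suc m)      ≡⟨ ℚ.*-assoc (fromℕℚ (suc p)) _ _ ⟨
    (fromℕℚ (suc p) * 1/suc p) * 1/suc m      ≡⟨ cong (_* 1/suc m) (1/suc-inverse p) ⟩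
    1ℚ * 1/suc m                              ≡⟨ ℚ.*-identityˡ (1/suc m) ⟩
    1/suc m                                   ∎
    where open ≡-Reasoning

  R L : ℕ → ℕ → ℚ
  R p m = H (suc m) (p ℕ.* suc m)
  L p m = H m (p ℕ.* suc m)

  private
    next : ∀ p m → suc (p ℕ.* suc (suc m)) ≡ p ℕ.* suc m ℕ.+ suc p
    next = ℕS.solve 2 (λ p m → con′ 1 ⊕ p ⊗ (con′ 2 ⊕ m) ⊜ p ⊗ (con′ 1 ⊕ m) ⊕ (con′ 1 ⊕ p)) refl
      where
      module ℕS = ℕ-Solver.+-*-Solver
      open ℕS using () renaming (_:+_ to _⊕_; _:*_ to _⊗_; _:=_ to _⊜_; con to con′)

    next-split : ∀ p m i → 1/suc i + H (suc i) (p ℕ.* suc (suc m)) ≡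
                 H i (p ℕ.* suc m) + H (i ℕ.+ p ℕ.* suc m) (suc p)
    next-split p m i = trans (sym (head i (p ℕ.* suc (suc m))))
      (trans (cong (H i) (next p m)) (split i (p ℕ.* suc m) (suc p)))

  R-mono-suc : ∀ p m → R p m ≤ R p (suc m)
  R-mono-suc p m = +-cancelˡ-≤ (1/suc (suc m)) (begin
    1/suc (suc m) + R p m                      ≡⟨ ℚ.+-comm (1/suc (suc m)) _ ⟩
    R p m + 1/suc (suc m)                      ≡⟨ cong (λ z → R p m + z) (step-suc p (suc m) k k≡) ⟨
    R p m + fromℕℚ (suc p) * 1/suc k           ≤⟨ ℚ.+-monoʳ-≤ (R p m) (lower i (suc p) k (ℕ.≤-reflexive (ℕ.+-suc i p))) ⟩
    R p m + H i (suc p)                        ≡⟨ next-split p m (suc m) ⟨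
    1/suc (suc m) + R p (suc m)                ∎)
    where
    open ℚ.≤-Reasoning
    i k : ℕ
    i = suc m ℕ.+ p ℕ.* suc m
    k = i ℕ.+ p
    k≡ : suc k ≡ suc p ℕ.* suc (suc m)
    k≡ = ℕS.solve 2 (λ p m → con′ 1 ⊕ ((con′ 1 ⊕ m ⊕ p ⊗ (con′ 1 ⊕ m)) ⊕ p) ⊜ (con′ 1 ⊕ p) ⊗ (con′ 2 ⊕ m)) refl p m
      where
      module ℕS = ℕ-Solver.+-*-Solver
      open ℕS using () renaming (_:+_ to _⊕_; _:*_ to _⊗_; _:=_ to _⊜_; con to con′)

  L-antitone-suc : ∀ p m → L p (suc m) ≤ L p m
  L-antitone-suc p m = +-cancelˡ-≤ (1/suc m) (begin
    1/suc m + L p (suc m)                      ≡⟨ next-split p m m ⟩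
    L p m + H k (suc p)                        ≤⟨ ℚ.+-monoʳ-≤ (L p m) (upper k (suc p)) ⟩
    L p m + fromℕℚ (suc p) * 1/suc k           ≡⟨ cong (λ z → L p m + z) (step-suc p m k refl) ⟩
    L p m + 1/suc m                            ≡⟨ ℚ.+-comm (L p m) _ ⟩
    1/suc m + L p m                            ∎)
    where
    open ℚ.≤-Reasoning
    k : ℕ
    k = m ℕ.+ p ℕ.* suc m

  R-mono : ∀ p {m k} → m ℕ.≤′ k → R p m ≤ R p k
  R-mono p (ℕ.≤′-reflexive refl) = ℚ.≤-refl
  R-mono p (ℕ.≤′-step h)         = ℚ.≤-trans (R-mono p h) (R-mono-suc p _)

  L-antitone : ∀ p {m k} → m ℕ.≤′ k → L p k ≤ L p m
  L-antitone p (ℕ.≤′-reflexive refl) = ℚ.≤-refl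
  L-antitone p (ℕ.≤′-step h)         = ℚ.≤-trans (L-antitone-suc p _) (L-antitone p h)

  H-antitone : ∀ m N → H (suc m) N ≤ H m N
  H-antitone m zero    = ℚ.≤-refl
  H-antitone m (suc N) = ℚ.+-mono-≤ (H-antitone m N) (1/suc-antitone (ℕ.n≤1+n (m ℕ.+ N)))

  R≤L : ∀ p m k → R p m ≤ L p k
  R≤L p m k with ℕ.≤-total m k
  ... | inj₁ m≤k = ℚ.≤-trans (R-mono p (ℕ.≤⇒≤′ m≤k)) (H-antitone k (p ℕ.* suc k))
  ... | inj₂ k≤m = ℚ.≤-trans (H-antitone m (p ℕ.* suc m)) (L-antitone p (ℕ.≤⇒≤′ k≤m))

  L≤R+ : ∀ p k → L p k ≤ R p k + 1/suc k
  L≤R+ p k = begin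
    L p k                                   ≤⟨ ≤-+ʳ (L p k) (0≤1/suc (k ℕ.+ p ℕ.* suc k)) ⟩
    H k (suc (p ℕ.* suc k))                 ≡⟨ head k (p ℕ.* suc k) ⟩
    1/suc k + R p k                         ≡⟨ ℚ.+-comm (1/suc k) _ ⟩
    R p k + 1/suc k                         ∎
    where open ℚ.≤-Reasoning

  log-approx≡R : ∀ n m → log-approx n m ≡ R (n ℕ.∸ 1) m
  log-approx≡R n m = rightSum≡harmonicSum m ((n ℕ.∸ 1) ℕ.* suc m)

  log-approx-rate : ∀ n m k → log-approx n m ≤ log-approx n k + 1/suc k
  log-approx-rate n m k = subst₂ (λ x y → x ≤ y + 1/suc k)
    (sym (log-approx≡R n m)) (sym (log-approx≡R n k))
    (ℚ.≤-trans (R≤L (n ℕ.∸ 1) m k) (L≤R+ (n ℕ.∸ 1) k))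

Eventually : (ℕ → Set) → Set
Eventually P = ∃ λ N → ∀ m → N ℕ.≤ m → P m

IsCauchy : (ℕ → ℚ) → Set
IsCauchy s = ∀ ε → 0ℚ ℚ.< ε →
  ∃ λ N → ∀ m n → N ℕ.≤ m → N ℕ.≤ n → ℚ.∣ s m ℚ.- s n ∣ ℚ.≤ ε

record ℝ : Set where
  constructor mkℝ
  field
    seq    : ℕ → ℚ
    cauchy : IsCauchy seq

open ℝ public

infix 4 _<_ _≤_

_<_ : ℝ → ℝ → Set
x < y = ∃ λ ε → 0ℚ ℚ.< ε × Eventually (λ m → seq x m ℚ.+ ε ℚ.≤ seq y m)

_≤_ : ℝ → ℝ → Set
x ≤ y = ∀ ε → 0ℚ ℚ.< ε → Eventually (λ m → seq x m ℚ.≤ seq y m ℚ.+ ε)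

module _ where
  open import Data.Rational.Base using (∣_∣)
  open ℚ-Solver.+-*-Solver
  open ℚ.≤-Reasoning

  private
    bounded : ∀ {s} → IsCauchy s → ∃ λ B → 0ℚ ℚ.< B × Eventually (λ m → ∣ s m ∣ ℚ.≤ B)
    bounded {s} s-cauchy with s-cauchy 1ℚ (from-yes (0ℚ ℚ.<? 1ℚ))
    ... | N , h = 1ℚ ℚ.+ ∣ s N ∣ , 0<+ (from-yes (0ℚ ℚ.<? 1ℚ)) (ℚ.0≤∣p∣ (s N)) , N , λ m N≤m → begin
      ∣ s m ∣                         ≡⟨ cong ∣_∣ (add-back (s m) (s N)) ⟩
      ∣ (s m ℚ.- s N) ℚ.+ s N ∣       ≤⟨ ℚ.∣p+q∣≤∣p∣+∣q∣ (s m ℚ.- s N) (s N) ⟩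
      ∣ s m ℚ.- s N ∣ ℚ.+ ∣ s N ∣     ≤⟨ ℚ.+-monoˡ-≤ ∣ s N ∣ (h m N N≤m ℕ.≤-refl) ⟩
      1ℚ ℚ.+ ∣ s N ∣                  ∎

    +-cauchy : ∀ {s t} → IsCauchy s → IsCauchy t → IsCauchy (λ m → s m ℚ.+ t m)
    +-cauchy {s} {t} s-cauchy t-cauchy ε 0<ε
      with s-cauchy (½ ℚ.* ε) (0<* 0<½ 0<ε) | t-cauchy (½ ℚ.* ε) (0<* 0<½ 0<ε)
    ... | M , p | N , q = M ℕ.⊔ N , λ m n hm hn →
      +-close {s m} {t m} {s n} {t n}
        (p m n (ℕ.m⊔n≤o⇒m≤o M N hm) (ℕ.m⊔n≤o⇒m≤o M N hn))
        (q m n (ℕ.m⊔n≤o⇒n≤o M N hm) (ℕ.m⊔n≤o⇒n≤o M N hn))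

    neg-cauchy : ∀ {s} → IsCauchy s → IsCauchy (λ m → ℚ.- s m)
    neg-cauchy {s} s-cauchy ε 0<ε with s-cauchy ε 0<ε
    ... | N , p = N , λ m n hm hn → begin
      ∣ ℚ.- s m ℚ.- ℚ.- s n ∣
        ≡⟨ cong ∣_∣ (neg-difference (s m) (s n)) ⟩
      ∣ s n ℚ.- s m ∣
        ≤⟨ p n m hn hm ⟩
      ε ∎

    *-cauchy : ∀ {s t} → IsCauchy s → IsCauchy t → IsCauchy (λ m → s m ℚ.* t m)
    *-cauchy {s} {t} s-cauchy t-cauchy ε 0<ε =
      combine (bounded {s} s-cauchy) (bounded {t} t-cauchy)
      where
      combine : (∃ λ A → 0ℚ ℚ.< A × Eventually (λ m → ∣ s m ∣ ℚ.≤ A)) →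
                (∃ λ B → 0ℚ ℚ.< B × Eventually (λ m → ∣ t m ∣ ℚ.≤ B)) →
                ∃ λ K → ∀ m n → K ℕ.≤ m → K ℕ.≤ n → ∣ s m ℚ.* t m ℚ.- s n ℚ.* t n ∣ ℚ.≤ ε
      combine (A , 0<A , I , a) (B , 0<B , J , b) = finish (s-cauchy δ 0<δ) (t-cauchy δ 0<δ)
        where
        0<A+B : 0ℚ ℚ.< A ℚ.+ B
        0<A+B = 0<+ 0<A (ℚ.<⇒≤ 0<B)
        δ : ℚ
        δ = recip (A ℚ.+ B) ℚ.* ε
        0<δ : 0ℚ ℚ.< δ
        0<δ = 0<* (0<recip 0<A+B) 0<ε
        δ-eq : (A ℚ.+ B) ℚ.* δ ≡ ε
        δ-eq = trans (sym (ℚ.*-assoc (A ℚ.+ B) (recip (A ℚ.+ B)) ε))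
          (trans (cong (ℚ._* ε) (recip-inverse 0<A+B)) (ℚ.*-identityˡ ε))
        finish : (∃ λ M → ∀ m n → M ℕ.≤ m → M ℕ.≤ n → ∣ s m ℚ.- s n ∣ ℚ.≤ δ) →
                 (∃ λ N → ∀ m n → N ℕ.≤ m → N ℕ.≤ n → ∣ t m ℚ.- t n ∣ ℚ.≤ δ) →
                 ∃ λ K → ∀ m n → K ℕ.≤ m → K ℕ.≤ n → ∣ s m ℚ.* t m ℚ.- s n ℚ.* t n ∣ ℚ.≤ ε
        finish (M , p) (N , q) = (I ℕ.⊔ J) ℕ.⊔ (M ℕ.⊔ N) , λ m n hm hn →
          subst (∣ s m ℚ.* t m ℚ.- s n ℚ.* t n ∣ ℚ.≤_) δ-eq
            (*-close {s m} {t m} {s n} {t n} (ℚ.<⇒≤ 0<A) (ℚ.<⇒≤ 0<δ)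
              (a m (ℕ.m⊔n≤o⇒m≤o I J (h₁ hm))) (b n (ℕ.m⊔n≤o⇒n≤o I J (h₁ hn)))
              (p m n (ℕ.m⊔n≤o⇒m≤o M N (h₂ hm)) (ℕ.m⊔n≤o⇒m≤o M N (h₂ hn)))
              (q m n (ℕ.m⊔n≤o⇒n≤o M N (h₂ hm)) (ℕ.m⊔n≤o⇒n≤o M N (h₂ hn))))
          where
          h₁ : ∀ {k} → (I ℕ.⊔ J) ℕ.⊔ (M ℕ.⊔ N) ℕ.≤ k → I ℕ.⊔ J ℕ.≤ k
          h₁ = ℕ.m⊔n≤o⇒m≤o (I ℕ.⊔ J) (M ℕ.⊔ N)
          h₂ : ∀ {k} → (I ℕ.⊔ J) ℕ.⊔ (M ℕ.⊔ N) ℕ.≤ k → M ℕ.⊔ N ℕ.≤ k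
          h₂ = ℕ.m⊔n≤o⇒n≤o (I ℕ.⊔ J) (M ℕ.⊔ N)

    recip-cauchy : ∀ {s} c → 0ℚ ℚ.< c → Eventually (λ m → c ℚ.≤ s m) →
                   IsCauchy s → IsCauchy (λ m → recip (s m))
    recip-cauchy {s} c 0<c (M , c≤s) s-cauchy ε 0<ε
      with s-cauchy (c ℚ.* c ℚ.* ε) (0<* (0<* 0<c 0<c) 0<ε)
    ... | N , p = M ℕ.⊔ N , λ m n hm hn →
      recip-close 0<c (c≤s m (ℕ.m⊔n≤o⇒m≤o M N hm)) (c≤s n (ℕ.m⊔n≤o⇒m≤o M N hn)) (ℚ.<⇒≤ 0<ε)
        (p m n (ℕ.m⊔n≤o⇒n≤o M N hm) (ℕ.m⊔n≤o⇒n≤o M N hn))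

  fromℚ : ℚ → ℝ
  fromℚ q = mkℝ (λ _ → q) λ ε 0<ε → 0 , λ _ _ _ _ →
    subst (ℚ._≤ ε) (sym (cong ∣_∣ (ℚ.+-inverseʳ q))) (ℚ.<⇒≤ 0<ε)

  infixl 6 _+_ _-_
  infixl 7 _*_ _÷_[_]
  infix  8 -_ _⁻¹[_]

  _+_ : ℝ → ℝ → ℝ
  x + y = mkℝ (λ m → seq x m ℚ.+ seq y m) (+-cauchy {seq x} {seq y} (cauchy x) (cauchy y))

  -_ : ℝ → ℝ
  -_ x = mkℝ (λ m → ℚ.- seq x m) (neg-cauchy {seq x} (cauchy x))

  _-_ : ℝ → ℝ → ℝ
  x - y = x + (- y)

  _*_ : ℝ → ℝ → ℝ
  x * y = mkℝ (λ m → seq x m ℚ.* seq y m) (*-cauchy {seq x} {seq y} (cauchy x) (cauchy y))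

  _⁻¹[_] : (x : ℝ) → fromℚ 0ℚ < x → ℝ
  x ⁻¹[ 0<x ] = mkℝ (λ m → recip (seq x m)) (is-cauchy 0<x)
    where
    is-cauchy : fromℚ 0ℚ < x → IsCauchy (λ m → recip (seq x m))
    is-cauchy (c , 0<c , N , h) = recip-cauchy {seq x} c 0<c
      (N , λ m N≤m → subst (ℚ._≤ seq x m) (ℚ.+-identityˡ c) (h m N≤m)) (cauchy x)

  _÷_[_] : ℝ → (y : ℝ) → fromℚ 0ℚ < y → ℝ
  x ÷ y [ 0<y ] = x * y ⁻¹[ 0<y ]

fromℕ : ℕ → ℝ
fromℕ n = fromℚ (fromℕℚ n)

fromRate : (s : ℕ → ℚ) → (∀ m k → s m ℚ.≤ s k ℚ.+ 1/suc k) → ℝ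
fromRate s rate = mkℝ s s-cauchy
  where
  s-cauchy : IsCauchy s
  s-cauchy ε 0<ε with archimedean ε 0<ε
  ... | N , 1/N≤ε = N , λ m n hm hn → ∣p-q∣≤ (step m n hn) (step n m hm)
    where
    step : ∀ m n → N ℕ.≤ n → s m ℚ.≤ s n ℚ.+ ε
    step m n hn = ℚ.≤-trans (rate m n) (ℚ.+-monoʳ-≤ (s n) (ℚ.≤-trans (1/suc-antitone hn) 1/N≤ε))

-- The m-th term is √n rounded down to a multiple of 1/(m+1).
√_ : ℕ → ℝ
√ n = fromRate (√-approx n) (√-approx-rate n)

infix 9 √_

-- log n = ∫₁ⁿ dt/t
log : ∀ n → .{{_ : NonZero n}} → ℝ
log n = fromRate (log-approx n) (LogLemmas.log-approx-rate n)

1≤⇒0< : ∀ x → fromℕ 1 ≤ x → fromℕ 0 < x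
1≤⇒0< x 1≤x with 1≤x ½ 0<½
... | N , h = ½ , 0<½ , N , λ m N≤m →
  +-cancelˡ-≤ ½ (subst (1ℚ ℚ.≤_) (ℚ.+-comm (seq x m) ½) (h m N≤m))

1≤√-approx : ∀ n .{{_ : NonZero n}} m → 1ℚ ℚ.≤ √-approx n m
1≤√-approx n m = begin
  1ℚ                                  ≡⟨ 1/suc-inverse m ⟨
  fromℕℚ (suc m) ℚ.* 1/suc m          ≤⟨ *-monoʳ (1/suc m) (0≤1/suc m) (fromℕℚ-mono sm≤) ⟩
  √-approx n m                        ∎
  where
  open ℚ.≤-Reasoning
  N : ℕ
  N = n ℕ.* (suc m ℕ.* suc m)
  sm≤ : suc m ℕ.≤ ⌊√ N ⌋
  sm≤ with suc m ℕ.≤? ⌊√ N ⌋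
  ... | yes h = h
  ... | no  h = contradiction
    (ℕ.≤-trans (⌊√⌋-upper N) (ℕ.*-mono-≤ (ℕ.≰⇒> h) (ℕ.≰⇒> h)))
    (ℕ.≤⇒≯ (ℕ.m≤n*m (suc m ℕ.* suc m) n))

≤√⇒0<2√- : ∀ x n .{{_ : NonZero n}} → x ≤ √ n → fromℕ 0 < fromℕ 2 * √ n - x
≤√⇒0<2√- x n x≤√n with x≤√n ½ 0<½
... | N , h = ½ , 0<½ , N , λ m N≤m → +-cancelˡ-≤ (seq x m ℚ.+ ½) (begin
  (seq x m ℚ.+ ½) ℚ.+ (0ℚ ℚ.+ ½)
    ≡⟨ trans (cong ((seq x m ℚ.+ ½) ℚ.+_) (ℚ.+-identityˡ ½)) (ℚ.+-assoc (seq x m) ½ ½) ⟩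
  seq x m ℚ.+ 1ℚ
    ≤⟨ ℚ.+-mono-≤ (h m N≤m) (1≤√-approx n m) ⟩
  (s m ℚ.+ ½) ℚ.+ s m
    ≡⟨ double-minus (seq x m) (s m) ½ ⟩
  (seq x m ℚ.+ ½) ℚ.+ ((s m ℚ.+ s m) ℚ.- seq x m)
    ≡⟨ cong (λ z → (seq x m ℚ.+ ½) ℚ.+ (z ℚ.- seq x m)) (two (s m)) ⟨
  (seq x m ℚ.+ ½) ℚ.+ (fromℕℚ 2 ℚ.* s m ℚ.- seq x m) ∎)
  where
  open ℚ.≤-Reasoning
  open ℚ-Solver.+-*-Solver
  s : ℕ → ℚ
  s = √-approx n
  two : ∀ p → fromℕℚ 2 ℚ.* p ≡ p ℚ.+ p
  two p = trans (ℚ.*-distribʳ-+ p 1ℚ 1ℚ) (cong₂ ℚ._+_ (ℚ.*-identityˡ p) (ℚ.*-identityˡ p))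

{-# OPTIONS --safe #-}
module Submission where

-- A solution has quotients u = (a x - 1) / y, v = (b y - 1) / x and
-- k = (a x + b y - 1) / (x y), and then k x = u + b, k y = v + a and
-- u v + k = n. Put X = √n / α.
--
-- If k > X, then x (2k - 1) ≤ 2n - 1 and likewise for y, so both coordinates
-- are below K = (2n - 1) / (2X - 1). They differ, and the larger one determines
-- the smaller, which is an inverse of a or b modulo it. This gives at most
-- 2 (K - 1) solutions, and 2K is the last term of the bound.
--
-- If k ≤ X, then u ≤ √n or v ≤ √n. As k ≡ n (mod u), each u ≤ √n admits at most
-- X / u + 1 values of k, and u and k determine the solution. Summing over u, and
-- symmetrically over v, gives 2 (X H + m) with m = ⌊√n⌋ and H the m-th harmonic
-- number, and H ≤ ½ log n + 3/5 + 1/(2m).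
--
-- Since X / m + 2m ≤ 2√n + 1, these add up to less than the claimed bound. The
-- argument is carried out for the rational approximations of α, √n and log n,
-- the margin in the last step absorbing the errors.

import Data.Integer.Base as ℤ
open import Data.List.Base using (List; []; _∷_; _++_; length; map; upTo)
open import Data.List.Membership.Propositional using (_∈_)
open import Data.List.Membership.Propositional.Properties
  using (∈-∃++; ∈-++⁺ˡ; ∈-++⁺ʳ; ∈-++⁻; ∈-map⁺; ∈-upTo⁺)
open import Data.List.Properties using (length-++; length-map; length-upTo)
import Data.List.Relation.Unary.All as All
open import Data.List.Relation.Unary.AllPairs using (_∷_)
open import Data.List.Relation.Unary.Any using (here; there)
open import Data.List.Relation.Unary.Unique.Propositional using (Unique)
open import Data.Nat.Base as ℕ using (ℕ; zero; suc; NonZero; z≤n; s≤s)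
open import Data.Nat.Coprimality using (Coprime; coprime-divisor)
open import Data.Nat.Divisibility
  using (_∣_; divides; ∣⇒≤; ∣1⇒≡1; ∣m+n∣m⇒∣n; ∣-trans; m∣m*n; n∣m*n)
open import Data.Nat.DivMod using (m≡m%n+[m/n]*n; [m+kn]%n≡m%n; /-monoˡ-≤; m*n/n≡m; m/n*n≤m)
import Data.Nat.Properties as ℕ
open import Data.Nat.Solver using () renaming (module +-*-Solver to ℕ-Solver)
open import Data.Product as Product using (∃; _×_; _,_; proj₁; proj₂)
open import Data.Rational.Base as ℚ using (ℚ; 0ℚ; 1ℚ; ½; _/_)
import Data.Rational.Properties as ℚ
open import Data.Rational.Solver using () renaming (module +-*-Solver to ℚ-Solver)
open import Data.Sum using (_⊎_; inj₁; inj₂)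
open import Relation.Binary.Definitions using (tri<; tri≈; tri>)
open import Relation.Binary.PropositionalEquality
  using (_≡_; _≢_; refl; sym; trans; cong; cong₂; subst; subst₂; module ≡-Reasoning)
open import Relation.Nullary using (yes; no; contradiction)
open import Relation.Nullary.Decidable using (from-yes)

-- Pigeonhole principle for an injective relation.

module Pigeonhole {A B : Set} (R : A → B → Set)
  (injective : ∀ {x x′ y} → R x y → R x′ y → x ≡ x′) where

  -- The match of the head is deleted from `ys`. By injectivity it matches no later element of `xs`,
  -- as these differ from the head, so what remains of `ys` still covers the tail.
  length-≤ : ∀ {xs} ys → Unique xs → (∀ {x} → x ∈ xs → ∃ λ y → y ∈ ys × R x y) →
             length xs ℕ.≤ length ys
  length-≤ {[]}     ys _               _ = z≤n
  length-≤ {x ∷ xs} ys (x∉xs ∷ unique) cover with cover (here refl)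
  ... | y , y∈ys , xRy with ∈-∃++ y∈ys
  ... | ls , rs , refl = begin
    suc (length xs)               ≤⟨ s≤s (length-≤ (ls ++ rs) unique cover′) ⟩
    suc (length (ls ++ rs))       ≡⟨ cong suc (length-++ ls) ⟩
    suc (length ls ℕ.+ length rs) ≡⟨ ℕ.+-suc (length ls) (length rs) ⟨
    length ls ℕ.+ suc (length rs) ≡⟨ length-++ ls ⟨
    length (ls ++ y ∷ rs)         ∎
    where
    open ℕ.≤-Reasoning
    cover′ : ∀ {x′} → x′ ∈ xs → ∃ λ y′ → y′ ∈ ls ++ rs × R x′ y′
    cover′ x′∈xs with cover (there x′∈xs)
    ... | y′ , y′∈ , x′Ry′ with ∈-++⁻ ls y′∈
    ... | inj₁ y′∈ls            = y′ , ∈-++⁺ˡ y′∈ls , x′Ry′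
    ... | inj₂ (there y′∈rs)    = y′ , ∈-++⁺ʳ ls y′∈rs , x′Ry′
    ... | inj₂ (here refl)      = contradiction (injective xRy x′Ry′) (All.lookup x∉xs x′∈xs)

-- The quotients of a solution.

module Counting where
  open import Data.Nat.Base using (_+_; _*_; _∸_; _≤_; _<_; _%_)
  open import Defs using (Admissible; admissiblePairs-sound; admissiblePairs-unique; ρ′; ⌊√_⌋; ⌊√⌋-upper)
  open ℕ-Solver

  -- The form `u * y + 1` avoids truncated subtraction. The equations are symmetric under exchanging
  -- `a`, `x`, `u` with `b`, `y`, `v`, so a fact about one coordinate carries over to the other by
  -- `swap`.
  record Quotients (a b x y : ℕ) : Set where
    field
      u v k : ℕ
      ax≡ : a * x ≡ u * y + 1
      by≡ : b * y ≡ v * x + 1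
      kx≡ : k * x ≡ u + b
      ky≡ : k * y ≡ v + a
      uv≡ : a * b ≡ u * v + k

  swap : ∀ {a b x y} → Quotients a b x y → Quotients b a y x
  swap {a} {b} q = record
    { u = v ; v = u ; k = k ; ax≡ = by≡ ; by≡ = ax≡ ; kx≡ = ky≡ ; ky≡ = kx≡
    ; uv≡ = trans (ℕ.*-comm b a) (trans uv≡ (cong (_+ k) (ℕ.*-comm u v))) }
    where open Quotients q

  module _ {a b : ℕ} .{{_ : NonZero a}} .{{_ : NonZero b}} where

    private
      remove-multiple : ∀ e d c z .{{_ : NonZero c}} → 1 < z → d ∣ e * d + c * z ∸ 1 →
                        ∃ λ q → c * z ≡ q * d + 1
      remove-multiple e d c z 1<z d∣ with c * z | ℕ.≤-trans (ℕ.<⇒≤ 1<z) (ℕ.m≤n*m z c)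
      ... | suc w | _ with ∣m+n∣m⇒∣n (subst (d ∣_) (cong (_∸ 1) (ℕ.+-suc (e * d) w)) d∣) (n∣m*n e)
      ... | divides q refl = q , ℕ.+-comm 1 (q * d)

    quotients : ∀ {x y} → Admissible a b (x , y) → Quotients a b x y
    quotients {x} {y} (1<x , 1<y , divides k eq)
      with remove-multiple a x b y 1<y (∣-trans (m∣m*n y) (divides k eq))
         | remove-multiple b y a x 1<x
             (subst (y ∣_) (cong (_∸ 1) (ℕ.+-comm (a * x) (b * y))) (∣-trans (n∣m*n x) (divides k eq)))
    ... | v , by≡ | u , ax≡ = record
      { u = u ; v = v ; k = k ; ax≡ = ax≡ ; by≡ = by≡
      ; kx≡ = ℕ.*-cancelʳ-≡ (k * x) (u + b) y (ℕ.+-cancelʳ-≡ 1 _ _ (begin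
          k * x * y + 1        ≡⟨ cong (_+ 1) (ℕ.*-assoc k x y) ⟩
          k * (x * y) + 1      ≡⟨ kxy+1≡ ⟩
          a * x + b * y        ≡⟨ cong (_+ b * y) ax≡ ⟩
          u * y + 1 + b * y    ≡⟨ solve 3 (λ u b y → u :* y :+ con 1 :+ b :* y := (u :+ b) :* y :+ con 1) refl u b y ⟩
          (u + b) * y + 1      ∎))
      ; ky≡ = ℕ.*-cancelʳ-≡ (k * y) (v + a) x (ℕ.+-cancelʳ-≡ 1 _ _ (begin
          k * y * x + 1        ≡⟨ solve 3 (λ k x y → k :* y :* x :+ con 1 := k :* (x :* y) :+ con 1) refl k x y ⟩
          k * (x * y) + 1      ≡⟨ kxy+1≡ ⟩
          a * x + b * y        ≡⟨ cong (a * x +_) by≡ ⟩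
          a * x + (v * x + 1)  ≡⟨ solve 3 (λ v a x → a :* x :+ (v :* x :+ con 1) := (v :+ a) :* x :+ con 1) refl v a x ⟩
          (v + a) * x + 1      ∎))
      -- In the product of the first two equations, the part `u * y + v * x + 1` is `k * (x * y)`,
      -- so `x * y` cancels.
      ; uv≡ = ℕ.*-cancelʳ-≡ (a * b) (u * v + k) (x * y) {{ℕ.m*n≢0 x y}} (begin
          a * b * (x * y)                        ≡⟨ solve 4 (λ a b x y → a :* b :* (x :* y) := (a :* x) :* (b :* y)) refl a b x y ⟩
          (a * x) * (b * y)                      ≡⟨ cong₂ _*_ ax≡ by≡ ⟩
          (u * y + 1) * (v * x + 1)              ≡⟨ solve 4 (λ u v x y → (u :* y :+ con 1) :* (v :* x :+ con 1)
                                                      := u :* v :* (x :* y) :+ (u :* y :+ (v :* x :+ con 1))) refl u v x y ⟩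
          u * v * (x * y) + (u * y + (v * x + 1)) ≡⟨ cong (u * v * (x * y) +_) (sym kxy≡) ⟩
          u * v * (x * y) + k * (x * y)          ≡⟨ ℕ.*-distribʳ-+ (x * y) (u * v) k ⟨
          (u * v + k) * (x * y)                  ∎)
      }
      where
      open ≡-Reasoning
      instance
        x≢0 : NonZero x
        x≢0 = ℕ.>-nonZero (ℕ.<⇒≤ 1<x)
        y≢0 : NonZero y
        y≢0 = ℕ.>-nonZero (ℕ.<⇒≤ 1<y)
      kxy+1≡ : k * (x * y) + 1 ≡ a * x + b * y
      kxy+1≡ = trans (cong (_+ 1) (sym eq))
        (ℕ.m∸n+n≡m (ℕ.≤-trans (ℕ.<⇒≤ 1<x) (ℕ.≤-trans (ℕ.m≤n*m x a) (ℕ.m≤m+n (a * x) (b * y)))))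
      kxy≡ : k * (x * y) ≡ u * y + (v * x + 1)
      kxy≡ = ℕ.+-cancelʳ-≡ 1 _ _ (trans kxy+1≡ (trans (cong₂ _+_ ax≡ by≡)
        (solve 2 (λ p q → p :+ con 1 :+ q := p :+ q :+ con 1) refl (u * y) (v * x + 1))))

    module _ {x y : ℕ} (1<x : 1 < x) (1<y : 1 < y) (q : Quotients a b x y) where
      open Quotients q
      private
        instance
          x≢0 : NonZero x
          x≢0 = ℕ.>-nonZero (ℕ.<⇒≤ 1<x)

      -- Otherwise `b * y` would be 1, while `y` exceeds 1.
      v≢0 : NonZero v
      v≢0 = ℕ.≢-nonZero λ v≡0 → ℕ.<-irrefl refl (begin-strict
        1          <⟨ 1<y ⟩
        y          ≤⟨ ℕ.m≤n*m y b ⟩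
        b * y      ≡⟨ by≡ ⟩
        v * x + 1  ≡⟨ cong (λ z → z * x + 1) v≡0 ⟩
        1          ∎)
        where open ℕ.≤-Reasoning

      k≢0 : NonZero k
      k≢0 = ℕ.≢-nonZero λ k≡0 → ℕ.<-irrefl refl (begin-strict
        0          <⟨ ℕ.>-nonZero⁻¹ b ⟩
        b          ≤⟨ ℕ.m≤n+m b u ⟩
        u + b      ≡⟨ kx≡ ⟨
        k * x      ≡⟨ cong (_* x) k≡0 ⟩
        0          ∎)
        where open ℕ.≤-Reasoning

      -- Multiply `2kx + 1 ≤ x + 2ab` by `y` and write `b * y` as `x + w`. The right side then
      -- exceeds the left by `(x - 1)(y - 2) + 2(a - 1)w`.
      2kx<x+2ab : 2 * (k * x) < x + 2 * (a * b)
      2kx<x+2ab = bound a x y refl refl refl 1<y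
        where
        x≤by : x ≤ b * y
        x≤by = ℕ.≤-trans (ℕ.m≤n*m x v {{v≢0}}) (subst (v * x ≤_) (sym by≡) (ℕ.m≤m+n (v * x) 1))
        -- The copies come with equations so that they can be matched against successors, which
        -- turns the factors of the slack into the naturals `a′`, `x′`, `y′`.
        bound : ∀ a′ x′ y′ → a′ ≡ a → x′ ≡ x → y′ ≡ y → 1 < y′ → 2 * (k * x) < x + 2 * (a * b)
        bound _ _ (suc zero) _ _ _ (s≤s ())
        bound (suc a′) (suc x′) (suc (suc y′)) refl refl refl _ with ℕ.m≤n⇒∃[o]m+o≡n x≤by
        ... | w , x+w≡by = ℕ.*-cancelʳ-≤ _ _ y (ℕ.+-cancelʳ-≤ 2 _ _ (begin
          suc (2 * (k * x)) * y + 2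
            ≡⟨ cong (λ z → suc (2 * z) * y + 2) kx≡ ⟩
          suc (2 * (u + b)) * y + 2
            ≡⟨ solve 3 (λ u b y → (con 1 :+ con 2 :* (u :+ b)) :* y :+ con 2
                 := con 2 :* (u :* y :+ con 1) :+ con 2 :* (b :* y) :+ y) refl u b y ⟩
          2 * (u * y + 1) + 2 * (b * y) + y
            ≡⟨ cong₂ (λ p r → 2 * p + 2 * r + y) (sym ax≡) (sym x+w≡by) ⟩
          2 * (a * x) + 2 * (x + w) + y
            ≤⟨ ℕ.m≤m+n _ (x′ * y′ + 2 * (a′ * w)) ⟩
          2 * (a * x) + 2 * (x + w) + y + (x′ * y′ + 2 * (a′ * w))
            ≡⟨ solve 4 (λ a′ x′ y′ w → let a = con 1 :+ a′ ; x = con 1 :+ x′ ; y = con 2 :+ y′ in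
                 con 2 :* (a :* x) :+ con 2 :* (x :+ w) :+ y :+ (x′ :* y′ :+ con 2 :* (a′ :* w))
                 := x :* y :+ con 2 :* (a :* (x :+ w)) :+ con 2) refl a′ x′ y′ w ⟩
          x * y + 2 * (a * (x + w)) + 2
            ≡⟨ cong (λ z → x * y + 2 * (a * z) + 2) x+w≡by ⟩
          x * y + 2 * (a * (b * y)) + 2
            ≡⟨ solve 4 (λ a b x y → x :* y :+ con 2 :* (a :* (b :* y)) :+ con 2
                 := (x :+ con 2 :* (a :* b)) :* y :+ con 2) refl a b x y ⟩
          (x + 2 * (a * b)) * y + 2 ∎))
          where open ℕ.≤-Reasoning

      -- From `F + 1 ≤ k` follows `x + x(2F + 1) ≤ 2kx < x + 2ab`. This is the bound by K in
      -- integers, with `F` in the role of the integer part of X.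
      x≤-large-k : ∀ {F} → F < k → x ≤ (2 * (a * b) ∸ 1) ℕ./ suc (2 * F)
      x≤-large-k {F} F<k = begin
        x                                  ≡⟨ m*n/n≡m x (suc (2 * F)) ⟨
        x * suc (2 * F) ℕ./ suc (2 * F)      ≤⟨ /-monoˡ-≤ (suc (2 * F)) (ℕ.≤-pred (ℕ.≤-trans step (ℕ.m≤n+m∸n (2 * (a * b)) 1))) ⟩
        (2 * (a * b) ∸ 1) ℕ./ suc (2 * F)    ∎
        where
        open ℕ.≤-Reasoning
        step : x * suc (2 * F) < 2 * (a * b)
        step = ℕ.+-cancelˡ-< x _ _ (begin-strict
          x + x * suc (2 * F)  ≡⟨ solve 2 (λ x F → x :+ x :* (con 1 :+ con 2 :* F) := con 2 :* ((con 1 :+ F) :* x)) refl x F ⟩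
          2 * (suc F * x)      ≤⟨ ℕ.*-monoʳ-≤ 2 (ℕ.*-monoˡ-≤ x F<k) ⟩
          2 * (k * x)          <⟨ 2kx<x+2ab ⟩
          x + 2 * (a * b)      ∎)

      -- If they were equal, `a * x ≡ u * x + 1` would make `x` divide 1.
      x≢y : x ≢ y
      x≢y refl = contradiction
        (∣1⇒≡1 (∣m+n∣m⇒∣n (subst (x ∣_) ax≡ (n∣m*n a)) (n∣m*n u)))
        (ℕ.>⇒≢ 1<x)

      -- Otherwise `u * v` alone would exceed `a * b`.
      u≤√⊎v≤√ : u ≤ ⌊√ a * b ⌋ ⊎ v ≤ ⌊√ a * b ⌋
      u≤√⊎v≤√ with u ℕ.≤? ⌊√ a * b ⌋ | v ℕ.≤? ⌊√ a * b ⌋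
      ... | yes u≤ | _      = inj₁ u≤
      ... | no _   | yes v≤ = inj₂ v≤
      ... | no u≰  | no v≰  = contradiction (⌊√⌋-upper (a * b)) (ℕ.≤⇒≯ (begin
        suc ⌊√ a * b ⌋ * suc ⌊√ a * b ⌋  ≤⟨ ℕ.*-mono-≤ (ℕ.≰⇒> u≰) (ℕ.≰⇒> v≰) ⟩
        u * v                            ≤⟨ ℕ.m≤m+n (u * v) k ⟩
        u * v + k                        ≡⟨ uv≡ ⟨
        a * b                            ∎))
        where open ℕ.≤-Reasoning

    -- b y ≡ 1 (mod x), so y is the inverse of b modulo x.
    smaller-unique : ∀ {x y y′} → Quotients a b x y → Quotients a b x y′ → y < x → y′ < x → y ≡ y′
    smaller-unique {x} p q y<x y′<x = ℕ.≤-antisym (below p q y<x) (below q p y′<x)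
      where
      below : ∀ {y y′} → Quotients a b x y → Quotients a b x y′ → y < x → y ≤ y′
      below {y} {y′} p q y<x = ℕ.m∸n≡0⇒m≤n (<∧∣⇒≡0 (ℕ.≤-<-trans (ℕ.m∸n≤m y y′) y<x) (coprime-divisor coprime x∣))
        where
        module p = Quotients p
        module q = Quotients q
        open ≡-Reasoning
        <∧∣⇒≡0 : ∀ {d} → d < x → x ∣ d → d ≡ 0
        <∧∣⇒≡0 {zero}  _   _   = refl
        <∧∣⇒≡0 {suc d} d<x x∣d = contradiction (∣⇒≤ x∣d) (ℕ.<⇒≱ d<x)
        coprime : Coprime x b
        coprime {d} (d∣x , d∣b) = ∣1⇒≡1 (∣m+n∣m⇒∣n
          (subst (d ∣_) p.by≡ (∣-trans d∣b (m∣m*n y))) (∣-trans d∣x (n∣m*n p.v)))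
        x∣ : x ∣ b * (y ∸ y′)
        x∣ = divides (p.v ∸ q.v) (begin
          b * (y ∸ y′)                    ≡⟨ ℕ.*-distribˡ-∸ b y y′ ⟩
          b * y ∸ b * y′                  ≡⟨ cong₂ _∸_ (trans p.by≡ (ℕ.+-comm (p.v * x) 1)) (trans q.by≡ (ℕ.+-comm (q.v * x) 1)) ⟩
          p.v * x ∸ q.v * x               ≡⟨ ℕ.*-distribʳ-∸ x p.v q.v ⟨
          (p.v ∸ q.v) * x                 ∎)

    -- k ≡ a b (mod u), so u and the quotient k / u determine k, and then x and y.
    quotient-unique : ∀ {x y x′ y′ i} → 1 < x → 1 < y →
      (p : Quotients a b x y) (q : Quotients a b x′ y′) →
      Quotients.u p ≡ suc i → Quotients.u q ≡ suc i →
      Quotients.k p ℕ./ suc i ≡ Quotients.k q ℕ./ suc i → (x , y) ≡ (x′ , y′)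
    quotient-unique {x} {y} {x′} {y′} {i} 1<x 1<y p q refl uq≡ k/≡ = cong₂ _,_ x≡ y≡
      where
      module p = Quotients p
      module q = Quotients q
      open ≡-Reasoning
      remainder : ∀ {x y} (r : Quotients a b x y) → Quotients.u r ≡ suc i →
                  Quotients.k r % suc i ≡ (a * b) % suc i
      remainder r refl = sym (trans
        (cong (_% suc i) (trans r.uv≡ (trans (ℕ.+-comm _ r.k) (cong (r.k +_) (ℕ.*-comm (suc i) r.v)))))
        ([m+kn]%n≡m%n r.k r.v (suc i)))
        where module r = Quotients r
      k≡ : p.k ≡ q.k
      k≡ = begin
        p.k                                      ≡⟨ m≡m%n+[m/n]*n p.k (suc i) ⟩
        p.k % suc i + p.k ℕ./ suc i * suc i        ≡⟨ cong₂ (λ r s → r + s * suc i) (trans (remainder p refl) (sym (remainder q uq≡))) k/≡ ⟩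
        q.k % suc i + q.k ℕ./ suc i * suc i        ≡⟨ m≡m%n+[m/n]*n q.k (suc i) ⟨
        q.k                                      ∎
      x≡ : x ≡ x′
      x≡ = ℕ.*-cancelˡ-≡ x x′ p.k {{k≢0 1<x 1<y p}} (begin
        p.k * x       ≡⟨ p.kx≡ ⟩
        suc i + b     ≡⟨ cong (_+ b) uq≡ ⟨
        q.u + b       ≡⟨ q.kx≡ ⟨
        q.k * x′      ≡⟨ cong (_* x′) k≡ ⟨
        p.k * x′      ∎)
      y≡ : y ≡ y′
      y≡ = ℕ.*-cancelˡ-≡ y y′ (suc i) (ℕ.+-cancelʳ-≡ 1 _ _ (begin
        suc i * y + 1   ≡⟨ p.ax≡ ⟨
        a * x           ≡⟨ cong (a *_) x≡ ⟩
        a * x′          ≡⟨ q.ax≡ ⟩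
        q.u * y′ + 1    ≡⟨ cong (λ z → z * y′ + 1) uq≡ ⟩
        suc i * y′ + 1  ∎))

  -- Codes of solutions and their number.

  quotientPairs : ℕ → ℕ → List (ℕ × ℕ)
  quotientPairs F zero    = []
  quotientPairs F (suc i) = map (i ,_) (upTo (suc (F ℕ./ suc i))) ++ quotientPairs F i

  ∈-quotientPairs : ∀ {F m i k} → i < m → k ≤ F → (i , k ℕ./ suc i) ∈ quotientPairs F m
  ∈-quotientPairs {F} {suc m} {i} i<1+m k≤F with ℕ.m≤n⇒m<n∨m≡n (ℕ.≤-pred i<1+m)
  ... | inj₁ i<m  = ∈-++⁺ʳ _ (∈-quotientPairs i<m k≤F)
  ... | inj₂ refl = ∈-++⁺ˡ (∈-map⁺ (i ,_) (∈-upTo⁺ (s≤s (/-monoˡ-≤ (suc i) k≤F))))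

  -- by-x and by-y hold the larger coordinate less 2; by-u and by-v hold u - 1
  -- and k / u, respectively v - 1 and k / v.
  data Code : Set where
    by-x by-y : ℕ → Code
    by-u by-v : ℕ × ℕ → Code

  -- A relation rather than a function: a solution with both `u` and `v` small has two codes. What
  -- matters is that a code determines its solution.
  data Encodes (a b : ℕ) : ℕ × ℕ → Code → Set where
    by-x : ∀ {z y} → Quotients a b (2 + z) y → y < 2 + z → Encodes a b (2 + z , y) (by-x z)
    by-y : ∀ {x z} → Quotients a b x (2 + z) → x < 2 + z → Encodes a b (x , 2 + z) (by-y z)
    by-u : ∀ {x y i j} → 1 < x → 1 < y → (q : Quotients a b x y) →
           Quotients.u q ≡ suc i → Quotients.k q ℕ./ suc i ≡ j → Encodes a b (x , y) (by-u (i , j))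
    by-v : ∀ {x y i j} → 1 < x → 1 < y → (q : Quotients a b x y) →
           Quotients.v q ≡ suc i → Quotients.k q ℕ./ suc i ≡ j → Encodes a b (x , y) (by-v (i , j))

  module _ {a b : ℕ} .{{_ : NonZero a}} .{{_ : NonZero b}} where

    encodes-injective : ∀ {p p′ c} → Encodes a b p c → Encodes a b p′ c → p ≡ p′
    encodes-injective (by-x p y<) (by-x q y′<) = cong (_ ,_) (smaller-unique p q y< y′<)
    encodes-injective (by-y p x<) (by-y q x′<) = cong (_, _) (smaller-unique (swap p) (swap q) x< x′<)
    encodes-injective (by-u 1<x 1<y p u≡ j≡) (by-u _ _ q u′≡ j′≡) =
      quotient-unique 1<x 1<y p q u≡ u′≡ (trans j≡ (sym j′≡))
    encodes-injective (by-v 1<x 1<y p v≡ j≡) (by-v _ _ q v′≡ j′≡) =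
      cong Product.swap (quotient-unique 1<y 1<x (swap p) (swap q) v≡ v′≡ (trans j≡ (sym j′≡)))

    module _ (F : ℕ) where
      private
        -- `F` is to be the integer part of X, and `G` then bounds both coordinates of a solution
        -- with `k > F`.
        G m : ℕ
        G = (2 * (a * b) ∸ 1) ℕ./ suc (2 * F)
        m = ⌊√ a * b ⌋

        large-k small-k codes : List Code
        -- The larger coordinate lies between 2 and `G`, which leaves `G ∸ 1` values for either
        -- order of the coordinates.
        large-k = map by-x (upTo (G ∸ 1)) ++ map by-y (upTo (G ∸ 1))
        small-k = map by-u (quotientPairs F m) ++ map by-v (quotientPairs F m)
        codes   = large-k ++ small-k

        below-G : ∀ {z} → 2 + z ≤ G → z ∈ upTo (G ∸ 1)
        below-G h = ∈-upTo⁺ (ℕ.m+n≤o⇒m≤o∸n _ (subst (_≤ G) (ℕ.+-comm 1 _) h))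

        encode : ∀ {p} → Admissible a b p → ∃ λ c → c ∈ codes × Encodes a b p c
        encode {x , y} adm@(1<x , 1<y , _) with Quotients.k (quotients adm) ℕ.≤? F | ℕ.<-cmp x y
        encode {x , suc (suc z)} adm@(1<x , 1<y , _) | no k≰F | tri< x<y _ _ =
          by-y z , ∈-++⁺ˡ (∈-++⁺ʳ (map by-x (upTo (G ∸ 1))) (∈-map⁺ by-y (below-G y≤G))) , by-y q x<y
          where
          q = quotients adm
          y≤G : 2 + z ≤ G
          y≤G = subst (λ n → 2 + z ≤ (2 * n ∸ 1) ℕ./ suc (2 * F)) (ℕ.*-comm b a)
            (x≤-large-k 1<y 1<x (swap q) (ℕ.≰⇒> k≰F))
        encode {x , suc zero} (_ , s≤s () , _) | no _ | tri< _ _ _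
        encode {x , y} adm@(1<x , 1<y , _) | no k≰F | tri≈ _ x≡y _ =
          contradiction x≡y (x≢y 1<x 1<y (quotients adm))
        encode {suc (suc z) , y} adm@(1<x , 1<y , _) | no k≰F | tri> _ _ y<x =
          by-x z , ∈-++⁺ˡ (∈-++⁺ˡ (∈-map⁺ by-x (below-G (x≤-large-k 1<x 1<y q (ℕ.≰⇒> k≰F))))) , by-x q y<x
          where q = quotients adm
        encode {suc zero , y} (s≤s () , _) | no _ | tri> _ _ _
        encode {x , y} adm@(1<x , 1<y , _) | yes k≤F | _ = small (u≤√⊎v≤√ 1<x 1<y q)
          where
          q = quotients adm
          open Quotients q
          positive : ∀ {w} → NonZero w → ∃ λ i → w ≡ suc i
          positive {suc i} _ = i , refl
          small : u ≤ m ⊎ v ≤ m → ∃ λ c → c ∈ codes × Encodes a b (x , y) c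
          -- `u` is the `v` of the swapped solution, hence nonzero.
          small (inj₁ u≤m) with positive (v≢0 1<y 1<x (swap q))
          ... | i , u≡ = by-u (i , k ℕ./ suc i)
            , ∈-++⁺ʳ large-k (∈-++⁺ˡ (∈-map⁺ by-u (∈-quotientPairs (subst (_≤ m) u≡ u≤m) k≤F)))
            , by-u 1<x 1<y q u≡ refl
          small (inj₂ v≤m) with positive (v≢0 1<x 1<y q)
          ... | i , v≡ = by-v (i , k ℕ./ suc i)
            , ∈-++⁺ʳ large-k (∈-++⁺ʳ (map by-u (quotientPairs F m))
                (∈-map⁺ by-v (∈-quotientPairs (subst (_≤ m) v≡ v≤m) k≤F)))
            , by-v 1<x 1<y q v≡ refl

        length-double : ∀ {A B : Set} (f g : A → B) (xs : List A) →
                        length (map f xs ++ map g xs) ≡ 2 * length xs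
        length-double f g xs = trans (length-++ (map f xs)) (trans
          (cong₂ _+_ (length-map f xs) (length-map g xs))
          (cong (length xs +_) (sym (ℕ.+-identityʳ (length xs)))))

      ρ′-≤ : ρ′ a b ≤ 2 * (G ∸ 1) + 2 * length (quotientPairs F m)
      ρ′-≤ = begin
        ρ′ a b                                           ≤⟨ Pigeonhole.length-≤ (Encodes a b) encodes-injective codes
                                                              (admissiblePairs-unique a b)
                                                              (λ {p} p∈ → encode (admissiblePairs-sound a b p p∈)) ⟩
        length codes                                     ≡⟨ length-++ large-k ⟩
        length large-k + length small-k                  ≡⟨ cong₂ _+_ (length-double by-x by-y (upTo (G ∸ 1)))
                                                              (length-double by-u by-v (quotientPairs F m)) ⟩
        2 * length (upTo (G ∸ 1)) + 2 * length (quotientPairs F m)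
          ≡⟨ cong (λ l → 2 * l + 2 * length (quotientPairs F m)) (length-upTo (G ∸ 1)) ⟩
        2 * (G ∸ 1) + 2 * length (quotientPairs F m)     ∎
        where open ℕ.≤-Reasoning

-- Harmonic sums and the logarithm.

module Logarithm where
  open import Data.Rational.Base using (_+_; _*_; _-_; _≤_)
  open import Defs using (fromℕℚ; 1/suc; harmonicSum; log-approx; module ℚ-Lemmas; module LogLemmas)
  open ℚ-Lemmas
  open LogLemmas

  ⅗ : ℚ
  ⅗ = ℤ.+ 3 / 5

  frac : ℕ → ℕ → ℚ
  frac p d = fromℕℚ p * 1/suc d

  *-cancel-suc : ∀ p d → p * fromℕℚ (suc d) * 1/suc d ≡ p
  *-cancel-suc p d = trans (ℚ.*-assoc p _ _) (trans (cong (p *_) (1/suc-inverse d)) (ℚ.*-identityʳ p))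

  ≤-*-1/suc : ∀ {x} y d → x * fromℕℚ (suc d) ≤ y → x ≤ y * 1/suc d
  ≤-*-1/suc {x} y d h = subst (_≤ y * 1/suc d) (*-cancel-suc x d) (*-monoʳ (1/suc d) (0≤1/suc d) h)

  *-1/suc-≤ : ∀ {x} y d → y ≤ x * fromℕℚ (suc d) → y * 1/suc d ≤ x
  *-1/suc-≤ {x} y d h = subst (y * 1/suc d ≤_) (*-cancel-suc x d) (*-monoʳ (1/suc d) (0≤1/suc d) h)

  frac-*-suc : ∀ p d → frac p d * fromℕℚ (suc d) ≡ fromℕℚ p
  frac-*-suc p d = trans (solve 3 (λ x y z → x :* y :* z := x :* z :* y) refl (fromℕℚ p) (1/suc d) (fromℕℚ (suc d)))
    (*-cancel-suc (fromℕℚ p) d)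
    where open ℚ-Solver

  -- Turns comparisons of explicit fractions into inequalities in ℕ that a polynomial identity
  -- settles.
  frac-mono : ∀ p d q e → p ℕ.* suc e ℕ.≤ q ℕ.* suc d → frac p d ≤ frac q e
  frac-mono p d q e h = ≤-*-1/suc (fromℕℚ q) e (subst (_≤ fromℕℚ q)
    (solve 3 (λ x y z → x :* y :* z := x :* z :* y) refl (fromℕℚ p) (fromℕℚ (suc e)) (1/suc d))
    (subst (λ z → z * 1/suc d ≤ fromℕℚ q) (fromℕℚ-* p (suc e))
      (subst (fromℕℚ (p ℕ.* suc e) * 1/suc d ≤_) (*-cancel-suc (fromℕℚ q) d)
        (*-monoʳ (1/suc d) (0≤1/suc d) (subst (fromℕℚ (p ℕ.* suc e) ≤_) (fromℕℚ-* q (suc d)) (fromℕℚ-mono h))))))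
    where open ℚ-Solver

  -- The index on the right is the predecessor of the product of denominators `suc d ℕ.* suc e`.
  frac-+ : ∀ p d q e → frac p d + frac q e ≡ frac (p ℕ.* suc e ℕ.+ q ℕ.* suc d) (e ℕ.+ d ℕ.* suc e)
  frac-+ p d q e = inverse-unique′ (suc d ℕ.* suc e) _ _ (begin
    (frac p d + frac q e) * fromℕℚ (suc d ℕ.* suc e)
      ≡⟨ cong ((frac p d + frac q e) *_) (fromℕℚ-* (suc d) (suc e)) ⟩
    (frac p d + frac q e) * (D * E)
      ≡⟨ solve 4 (λ x y d e → (x :+ y) :* (d :* e) := x :* d :* e :+ y :* e :* d) refl (frac p d) (frac q e) D E ⟩
    frac p d * D * E + frac q e * E * D
      ≡⟨ cong₂ (λ x y → x * E + y * D) (frac-*-suc p d) (frac-*-suc q e) ⟩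
    fromℕℚ p * E + fromℕℚ q * D
      ≡⟨ cong₂ _+_ (fromℕℚ-* p (suc e)) (fromℕℚ-* q (suc d)) ⟨
    fromℕℚ (p ℕ.* suc e) + fromℕℚ (q ℕ.* suc d)
      ≡⟨ fromℕℚ-+ (p ℕ.* suc e) (q ℕ.* suc d) ⟨
    fromℕℚ (p ℕ.* suc e ℕ.+ q ℕ.* suc d)
      ≡⟨ frac-*-suc (p ℕ.* suc e ℕ.+ q ℕ.* suc d) (e ℕ.+ d ℕ.* suc e) ⟨
    frac (p ℕ.* suc e ℕ.+ q ℕ.* suc d) (e ℕ.+ d ℕ.* suc e) * fromℕℚ (suc d ℕ.* suc e) ∎)
    where
    open ≡-Reasoning
    open ℚ-Solver
    D E : ℚ
    D = fromℕℚ (suc d)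
    E = fromℕℚ (suc e)
    inverse-unique′ : ∀ k .{{_ : NonZero k}} x y → x * fromℕℚ k ≡ y * fromℕℚ k → x ≡ y
    inverse-unique′ (suc k) x y h = trans (sym (*-cancel-suc x k)) (trans (cong (_* 1/suc k) h) (*-cancel-suc y k))

  -- The terms equidistant from both ends pair up by 1/s + 1/t ≥ 4/(s + t).
  harmonicSum-midpoint : ∀ c N → fromℕℚ (2 ℕ.* N) ≤ harmonicSum c N * fromℕℚ (2 ℕ.* c ℕ.+ suc N)
  harmonicSum-midpoint c zero = ℚ.≤-reflexive (sym (ℚ.*-zeroˡ (fromℕℚ (2 ℕ.* c ℕ.+ 1))))
  harmonicSum-midpoint c (suc zero) = ℚ.≤-reflexive (sym (begin
    harmonicSum c 1 * fromℕℚ (2 ℕ.* c ℕ.+ 2)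
      ≡⟨ cong₂ (λ x y → x * fromℕℚ y) (trans (ℚ.+-identityˡ _) (cong 1/suc (ℕ.+-identityʳ c)))
           (ℕ-Solver.solve 1 (λ c → con 2 :* c :+ con 2 := (con 1 :+ c) :* con 2) refl c) ⟩
    1/suc c * fromℕℚ (suc c ℕ.* 2)
      ≡⟨ cong (1/suc c *_) (fromℕℚ-* (suc c) 2) ⟩
    1/suc c * (fromℕℚ (suc c) * fromℕℚ 2)
      ≡⟨ ℚ.*-assoc (1/suc c) (fromℕℚ (suc c)) (fromℕℚ 2) ⟨
    1/suc c * fromℕℚ (suc c) * fromℕℚ 2
      ≡⟨ cong (_* fromℕℚ 2) (trans (ℚ.*-comm (1/suc c) _) (1/suc-inverse c)) ⟩
    1ℚ * fromℕℚ 2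
      ≡⟨ ℚ.*-identityˡ (fromℕℚ 2) ⟩
    fromℕℚ 2 ∎))
    where
    open ≡-Reasoning
    open ℕ-Solver using (con; _:*_; _:+_; _:=_)
  -- Both end terms are split off. The first and last denominators of the inner sum add up to the
  -- same number as the outer ones, so the weight `w` is common.
  harmonicSum-midpoint c (suc (suc N)) = begin
    fromℕℚ (2 ℕ.* (2 ℕ.+ N))
      ≡⟨ trans (cong fromℕℚ (ℕ-Solver.solve 1 (λ N → con 2 ⊗ (con 2 ⊕ N) ⊜ con 2 ⊗ N ⊕ con 4) refl N)) (fromℕℚ-+ (2 ℕ.* N) 4) ⟩
    fromℕℚ (2 ℕ.* N) + fromℕℚ 4
      ≤⟨ ℚ.+-mono-≤ (harmonicSum-midpoint (suc c) N) (ends (fromℕℚ (suc c)) (fromℕℚ (suc d)) (1/suc c) (1/suc d)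
           (fromℕℚ-mono (s≤s (ℕ.m≤m+n c (suc N)))) (0≤1/suc c) (0≤1/suc d) (1/suc-inverse c) (1/suc-inverse d)) ⟩
    inner * fromℕℚ (2 ℕ.* suc c ℕ.+ suc N) + (fromℕℚ (suc c) + fromℕℚ (suc d)) * (1/suc c + 1/suc d)
      ≡⟨ cong₂ (λ p q → inner * fromℕℚ p + q * (1/suc c + 1/suc d))
           (ℕ-Solver.solve 2 (λ c N → con 2 ⊗ (con 1 ⊕ c) ⊕ (con 1 ⊕ N) ⊜ con 2 ⊗ c ⊕ (con 3 ⊕ N)) refl c N)
           (trans (sym (fromℕℚ-+ (suc c) (suc d))) (cong fromℕℚ
             (ℕ-Solver.solve 2 (λ c N → (con 1 ⊕ c) ⊕ (con 1 ⊕ (c ⊕ (con 1 ⊕ N))) ⊜ con 2 ⊗ c ⊕ (con 3 ⊕ N)) refl c N))) ⟩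
    inner * w + w * (1/suc c + 1/suc d)
      ≡⟨ ℚ-Solver.solve 4 (λ x y z w → x :* w :+ w :* (y :+ z) := (y :+ x :+ z) :* w) refl inner (1/suc c) (1/suc d) w ⟩
    (1/suc c + inner + 1/suc d) * w
      ≡⟨ cong (λ z → (z + 1/suc d) * w) (head c N) ⟨
    harmonicSum c (2 ℕ.+ N) * w ∎
    where
    open ℚ.≤-Reasoning
    open ℕ-Solver using (con) renaming (_:*_ to _⊗_; _:+_ to _⊕_; _:=_ to _⊜_)
    open ℚ-Solver using (_:*_; _:+_; _:-_; _:=_) renaming (con to conℚ)
    d : ℕ
    d = c ℕ.+ suc N
    inner w : ℚ
    inner = harmonicSum (suc c) N
    w = fromℕℚ (2 ℕ.* c ℕ.+ (3 ℕ.+ N))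
    ends : ∀ s t s⁻¹ t⁻¹ → s ≤ t → 0ℚ ≤ s⁻¹ → 0ℚ ≤ t⁻¹ → s * s⁻¹ ≡ 1ℚ → t * t⁻¹ ≡ 1ℚ →
           fromℕℚ 4 ≤ (s + t) * (s⁻¹ + t⁻¹)
    ends s t s⁻¹ t⁻¹ s≤t 0≤s⁻¹ 0≤t⁻¹ s-inv t-inv = begin
      -- The slack is `(t - s)² / (s t)`.
      fromℕℚ 4
        ≤⟨ ≤-+ʳ (fromℕℚ 4) (0≤* (0≤* 0≤t-s 0≤t-s) (0≤* 0≤s⁻¹ 0≤t⁻¹)) ⟩
      fromℕℚ 4 + (t - s) * (t - s) * (s⁻¹ * t⁻¹)
        ≡⟨ ℚ-Solver.solve 4 (λ s t a b → conℚ (fromℕℚ 4) :+ (t :- s) :* (t :- s) :* (a :* b)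
             := conℚ (fromℕℚ 4) :+ ((t :* b) :* (t :* a) :+ (s :* a) :* (s :* b) :- conℚ (fromℕℚ 2) :* ((s :* a) :* (t :* b))))
             refl s t s⁻¹ t⁻¹ ⟩
      fromℕℚ 4 + (t * t⁻¹ * (t * s⁻¹) + s * s⁻¹ * (s * t⁻¹) - fromℕℚ 2 * (s * s⁻¹ * (t * t⁻¹)))
        ≡⟨ cong₂ (λ p q → fromℕℚ 4 + (q * (t * s⁻¹) + p * (s * t⁻¹) - fromℕℚ 2 * (p * q))) s-inv t-inv ⟩
      fromℕℚ 4 + (1ℚ * (t * s⁻¹) + 1ℚ * (s * t⁻¹) - fromℕℚ 2 * (1ℚ * 1ℚ))
        ≡⟨ ℚ-Solver.solve 2 (λ p q → conℚ (fromℕℚ 4) :+ (conℚ 1ℚ :* p :+ conℚ 1ℚ :* q :- conℚ (fromℕℚ 2) :* (conℚ 1ℚ :* conℚ 1ℚ))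
             := conℚ 1ℚ :+ conℚ 1ℚ :+ p :+ q) refl (t * s⁻¹) (s * t⁻¹) ⟩
      1ℚ + 1ℚ + t * s⁻¹ + s * t⁻¹
        ≡⟨ cong₂ (λ p q → p + q + t * s⁻¹ + s * t⁻¹) s-inv t-inv ⟨
      s * s⁻¹ + t * t⁻¹ + t * s⁻¹ + s * t⁻¹
        ≡⟨ ℚ-Solver.solve 4 (λ s t a b → s :* a :+ t :* b :+ t :* a :+ s :* b := (s :+ t) :* (a :+ b)) refl s t s⁻¹ t⁻¹ ⟩
      (s + t) * (s⁻¹ + t⁻¹) ∎
      where
      0≤t-s : 0ℚ ≤ t - s
      0≤t-s = subst (_≤ t - s) (ℚ.+-inverseʳ s) (ℚ.+-monoˡ-≤ (ℚ.- s) s≤t)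

  -- With mesh 1/80, the midpoint rule bounds log((m+1)/m) below by
  -- 160/(160m + 81). What 1/m exceeds this by is telescoped by 81/(160m - 40),
  -- whose index here is m - 1.
  tail : ℕ → ℚ
  tail i = frac 81 (160 ℕ.* i ℕ.+ 119)

  tail-step : ∀ i → 1/suc i + tail (suc i) ≤ frac 160 (160 ℕ.* i ℕ.+ 240) + tail i
  tail-step i = subst₂ _≤_
    (trans (sym (frac-+ 1 i 81 (160 ℕ.* suc i ℕ.+ 119))) (cong (_+ tail (suc i)) (ℚ.*-identityˡ (1/suc i))))
    (sym (frac-+ 160 (160 ℕ.* i ℕ.+ 240) 81 (160 ℕ.* i ℕ.+ 119)))
    (frac-mono (1 ℕ.* suc e₁ ℕ.+ 81 ℕ.* suc i) (e₁ ℕ.+ i ℕ.* suc e₁) (160 ℕ.* suc e₀ ℕ.+ 81 ℕ.* suc d) (e₀ ℕ.+ d ℕ.* suc e₀)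
      -- After cross multiplication the two sides differ by exactly `12960 i + 401760`.
      (ℕ.≤-trans (ℕ.m≤m+n _ (12960 ℕ.* i ℕ.+ 401760)) (ℕ.≤-reflexive (identity i))))
    where
    e₀ e₁ d : ℕ
    e₀ = 160 ℕ.* i ℕ.+ 119
    e₁ = 160 ℕ.* suc i ℕ.+ 119
    d = 160 ℕ.* i ℕ.+ 240
    open ℕ-Solver
    identity : ∀ i → let e₀ = 160 ℕ.* i ℕ.+ 119 ; e₁ = 160 ℕ.* suc i ℕ.+ 119 ; d = 160 ℕ.* i ℕ.+ 240 in
      (1 ℕ.* suc e₁ ℕ.+ 81 ℕ.* suc i) ℕ.* suc (e₀ ℕ.+ d ℕ.* suc e₀) ℕ.+ (12960 ℕ.* i ℕ.+ 401760)
      ≡ (160 ℕ.* suc e₀ ℕ.+ 81 ℕ.* suc d) ℕ.* suc (e₁ ℕ.+ i ℕ.* suc e₁)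
    identity = solve 1 (λ i →
      let e₀ = con 160 :* i :+ con 119 ; e₁ = con 160 :* (con 1 :+ i) :+ con 119 ; d = con 160 :* i :+ con 240 in
      (con 1 :* (con 1 :+ e₁) :+ con 81 :* (con 1 :+ i)) :* (con 1 :+ (e₀ :+ d :* (con 1 :+ e₀)))
        :+ (con 12960 :* i :+ con 401760)
      := (con 160 :* (con 1 :+ e₀) :+ con 81 :* (con 1 :+ d)) :* (con 1 :+ (e₁ :+ i :* (con 1 :+ e₁)))) refl

  -- `R (suc i) 79` is the right Riemann sum of mesh 1/80 for log (i + 2). Raising `i` adds one
  -- harmonic term on the left and the Riemann sum over a unit interval on the right, and
  -- `tail-step` compares the two.
  harmonicSum-log : ∀ i → harmonicSum 0 (suc i) + tail (suc i) ≤ R (suc i) 79 + ⅗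
  -- By evaluation: 1 + 81/280 against 3/5 plus the 80 terms for log 2.
  harmonicSum-log zero = from-yes (harmonicSum 0 1 + tail 1 ℚ.≤? R 1 79 + ⅗)
  harmonicSum-log (suc i) = begin
    h + 1/suc (suc i) + tail (2 ℕ.+ i)
      ≡⟨ ℚ.+-assoc h (1/suc (suc i)) (tail (2 ℕ.+ i)) ⟩
    h + (1/suc (suc i) + tail (2 ℕ.+ i))
      ≤⟨ ℚ.+-monoʳ-≤ h (ℚ.≤-trans (tail-step (suc i)) (ℚ.+-monoˡ-≤ (tail (suc i)) block-lower)) ⟩
    h + (block + tail (suc i))
      ≡⟨ solve 3 (λ h b t → h :+ (b :+ t) := b :+ (h :+ t)) refl h block (tail (suc i)) ⟩
    block + (h + tail (suc i))
      ≤⟨ ℚ.+-monoʳ-≤ block (harmonicSum-log i) ⟩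
    block + (R (suc i) 79 + ⅗)
      ≡⟨ solve 3 (λ b r c → b :+ (r :+ c) := r :+ b :+ c) refl block (R (suc i) 79) ⅗ ⟩
    R (suc i) 79 + block + ⅗
      ≡⟨ cong (_+ ⅗) (split 80 (suc i ℕ.* 80) 80) ⟨
    harmonicSum 80 (suc i ℕ.* 80 ℕ.+ 80) + ⅗
      ≡⟨ cong (λ N → harmonicSum 80 N + ⅗) (ℕ.+-comm (suc i ℕ.* 80) 80) ⟩
    R (2 ℕ.+ i) 79 + ⅗ ∎
    where
    open ℚ.≤-Reasoning
    open ℚ-Solver
    c : ℕ
    c = 80 ℕ.+ suc i ℕ.* 80
    h block : ℚ
    h = harmonicSum 0 (suc i)
    -- The part of the Riemann sum lying over the interval from i + 2 to i + 3.
    block = harmonicSum c 80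
    block-lower : frac 160 (160 ℕ.* suc i ℕ.+ 240) ≤ block
    block-lower = *-1/suc-≤ (fromℕℚ 160) (160 ℕ.* suc i ℕ.+ 240)
      (subst (λ N → fromℕℚ 160 ≤ block * fromℕℚ N)
        (ℕ-Solver.solve 1 (λ i → con′ 2 ⊗ (con′ 80 ⊕ i ⊗ con′ 80) ⊕ con′ 81 ⊜ con′ 1 ⊕ (con′ 160 ⊗ i ⊕ con′ 240))
          refl (suc i))
        (harmonicSum-midpoint c 80))
      where open ℕ-Solver using () renaming (con to con′; _:*_ to _⊗_; _:+_ to _⊕_; _:=_ to _⊜_)

  harmonicSum-mono : ∀ c {N N′} → N ℕ.≤ N′ → harmonicSum c N ≤ harmonicSum c N′
  harmonicSum-mono c {N} N≤N′ with ℕ.m≤n⇒∃[o]m+o≡n N≤N′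
  ... | o , refl = subst (harmonicSum c N ≤_) (sym (split c N o)) (≤-+ʳ (harmonicSum c N) (0≤harmonicSum (c ℕ.+ N) o))
    where
    0≤harmonicSum : ∀ c N → 0ℚ ≤ harmonicSum c N
    0≤harmonicSum c zero    = ℚ.≤-refl
    0≤harmonicSum c (suc N) = ℚ.+-mono-≤ (0≤harmonicSum c N) (0≤1/suc (c ℕ.+ N))

  0≤log-approx : ∀ n M → 0ℚ ≤ log-approx n M
  0≤log-approx n M = subst (0ℚ ≤_) (sym (log-approx≡R n M)) (harmonicSum-mono (suc M) {0} {(n ℕ.∸ 1) ℕ.* suc M} z≤n)

  -- Put q = p + 1. Refining the mesh by the factor q increases the right sum of the decreasing
  -- function 1/t. By scaling, the refined sum on [1, q] is the sum of mesh 1/(M + 1) on [q, q²],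
  -- which continues the first one.
  log-approx-square : ∀ n p M → suc p ℕ.* suc p ℕ.≤ n → R p M + R p M ≤ log-approx n M
  log-approx-square n p M p²≤n = begin
    R p M + R p M
      ≤⟨ ℚ.+-monoʳ-≤ (R p M) (R-mono p (ℕ.≤⇒≤′ (ℕ.m≤m+n M (p ℕ.* suc M)))) ⟩
    R p M + R p (M ℕ.+ p ℕ.* suc M)
      ≡⟨ split (suc M) (p ℕ.* suc M) (p ℕ.* (suc p ℕ.* suc M)) ⟨
    harmonicSum (suc M) (p ℕ.* suc M ℕ.+ p ℕ.* (suc p ℕ.* suc M))
      ≤⟨ harmonicSum-mono (suc M) {N′ = (n ℕ.∸ 1) ℕ.* suc M} (ℕ.≤-trans (ℕ.≤-reflexive (identity p (suc M)))
           (ℕ.*-monoˡ-≤ (suc M) (ℕ.m+n≤o⇒m≤o∸n (p ℕ.+ p ℕ.* suc p) (subst (ℕ._≤ n) (ℕ.+-comm 1 (p ℕ.+ p ℕ.* suc p)) p²≤n)))) ⟩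
    R (n ℕ.∸ 1) M
      ≡⟨ log-approx≡R n M ⟨
    log-approx n M ∎
    where
    open ℚ.≤-Reasoning
    open ℕ-Solver
    identity : ∀ p k → p ℕ.* k ℕ.+ p ℕ.* (suc p ℕ.* k) ≡ (p ℕ.+ p ℕ.* suc p) ℕ.* k
    identity = solve 2 (λ p k → p :* k :+ p :* ((con 1 :+ p) :* k) := (p :+ p :* (con 1 :+ p)) :* k) refl

  -- With m = p + 1, half of the last term 1/m is absorbed by `tail p` for m > 1, and
  -- `harmonicSum-log` bounds the rest by log m + 3/5. The condition on `M` allows passing from mesh
  -- 1/80 to a finer one.
  harmonicSum-≤-log : ∀ n p M → suc p ℕ.* suc p ℕ.≤ n → 79 ℕ.≤ M →
    harmonicSum 0 (suc p) ≤ ½ * log-approx n M + ⅗ + ½ * 1/suc p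
  harmonicSum-≤-log n zero M _ _ = begin
    1ℚ                                             ≤⟨ from-yes (1ℚ ℚ.≤? ⅗ + ½ * 1ℚ) ⟩
    ⅗ + ½ * 1ℚ                               ≡⟨ cong (_+ ½ * 1ℚ) (ℚ.+-identityˡ ⅗) ⟨
    0ℚ + ⅗ + ½ * 1ℚ                          ≤⟨ ℚ.+-monoˡ-≤ (½ * 1ℚ) (ℚ.+-monoˡ-≤ ⅗
                                                        (0≤* (ℚ.<⇒≤ 0<½) (0≤log-approx n M))) ⟩
    ½ * log-approx n M + ⅗ + ½ * 1ℚ          ∎
    where open ℚ.≤-Reasoning
  harmonicSum-≤-log n (suc i) M p²≤n 79≤M = begin
    h + 1/suc (suc i)
      ≡⟨ cong (h +_) (half+half (1/suc (suc i))) ⟨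
    h + (r + r)
      ≤⟨ ℚ.+-monoʳ-≤ h (ℚ.+-monoˡ-≤ r r≤tail) ⟩
    h + (tail (suc i) + r)
      ≡⟨ ℚ.+-assoc h (tail (suc i)) r ⟨
    h + tail (suc i) + r
      ≤⟨ ℚ.+-monoˡ-≤ r (harmonicSum-log i) ⟩
    R (suc i) 79 + ⅗ + r
      ≤⟨ ℚ.+-monoˡ-≤ r (ℚ.+-monoˡ-≤ ⅗ (R-mono (suc i) (ℕ.≤⇒≤′ 79≤M))) ⟩
    R (suc i) M + ⅗ + r
      ≡⟨ cong (λ z → z + ⅗ + r) (trans (sym (half+half (R (suc i) M))) (sym (ℚ.*-distribˡ-+ ½ (R (suc i) M) (R (suc i) M)))) ⟩
    ½ * (R (suc i) M + R (suc i) M) + ⅗ + r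
      ≤⟨ ℚ.+-monoˡ-≤ r (ℚ.+-monoˡ-≤ ⅗ (*-monoˡ ½ (ℚ.<⇒≤ 0<½) (log-approx-square n (suc i) M p²≤n))) ⟩
    ½ * log-approx n M + ⅗ + r ∎
    where
    open ℚ.≤-Reasoning
    h r : ℚ
    h = harmonicSum 0 (suc i)
    r = ½ * 1/suc (suc i)
    r≤tail : r ≤ tail (suc i)
    r≤tail = subst (_≤ tail (suc i)) (trans (ℚ.*-identityˡ _) (sym (1/suc-* 1 (suc i) _ refl)))
      (frac-mono 1 (suc i ℕ.+ 1 ℕ.* suc (suc i)) 81 (160 ℕ.* suc i ℕ.+ 119)
        (ℕ.≤-trans (ℕ.m≤m+n _ (2 ℕ.* i ℕ.+ 44)) (ℕ.≤-reflexive
          (solve 1 (λ i → con 1 :* (con 1 :+ (con 160 :* (con 1 :+ i) :+ con 119)) :+ (con 2 :* i :+ con 44)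
                       := con 81 :* (con 1 :+ ((con 1 :+ i) :+ con 1 :* (con 2 :+ i)))) refl i))))
      where open ℕ-Solver

-- The bound for rational approximations.

module Estimates where
  open import Data.Rational.Base using (_+_; _*_; _-_; _≤_; _<_)
  open import Defs using (fromℕℚ; 1/suc; recip; harmonicSum; log-approx; √-approx; 1≤√-approx;
    ⌊√_⌋; ⌊√⌋-lower; ⌊√⌋-upper; square-cancel-≤; ρ′; module ℚ-Lemmas)
  open ℚ-Lemmas
  open Logarithm
  open Counting

  p≤q⇒0≤q-p : ∀ {p q} → p ≤ q → 0ℚ ≤ q - p
  p≤q⇒0≤q-p {p} {q} p≤q = subst (_≤ q - p) (ℚ.+-inverseʳ p) (ℚ.+-monoˡ-≤ (ℚ.- p) p≤q)

  ≤-by-difference : ∀ {p q} d → 0ℚ ≤ d → p + d ≡ q → p ≤ q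
  ≤-by-difference {p} d 0≤d refl = ≤-+ʳ p 0≤d

  floor : ∀ x B → 0ℚ ≤ x → x < fromℕℚ B → ∃ λ F → fromℕℚ F ≤ x × x < fromℕℚ (suc F)
  floor x zero    0≤x x<0 = contradiction (ℚ.≤-<-trans 0≤x x<0) (ℚ.<-irrefl refl)
  floor x (suc B) 0≤x x<1+B with fromℕℚ B ℚ.≤? x
  ... | yes B≤x = B , B≤x , x<1+B
  ... | no  B≰x = floor x B 0≤x (ℚ.≰⇒> B≰x)

  ⌊√⌋-greatest : ∀ p N → p ℕ.* p ℕ.≤ N → p ℕ.≤ ⌊√ N ⌋
  ⌊√⌋-greatest p N p²≤N with p ℕ.≤? ⌊√ N ⌋
  ... | yes p≤ = p≤
  ... | no  p≰ = contradiction (ℕ.<-≤-trans (⌊√⌋-upper N) (ℕ.*-mono-≤ (ℕ.≰⇒> p≰) (ℕ.≰⇒> p≰))) (ℕ.≤⇒≯ p²≤N)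

  ⌊√⌋≤√-approx : ∀ n M → fromℕℚ ⌊√ n ⌋ ≤ √-approx n M
  ⌊√⌋≤√-approx n M = ≤-*-1/suc (fromℕℚ ⌊√ N ⌋) M (subst (_≤ fromℕℚ ⌊√ N ⌋) (fromℕℚ-* ⌊√ n ⌋ (suc M))
    (fromℕℚ-mono (⌊√⌋-greatest (⌊√ n ⌋ ℕ.* suc M) N (subst (ℕ._≤ N)
      (solve 2 (λ p k → p :* p :* (k :* k) := p :* k :* (p :* k)) refl ⌊√ n ⌋ (suc M))
      (ℕ.*-monoˡ-≤ (suc M ℕ.* suc M) (⌊√⌋-lower n))))))
    where
    open ℕ-Solver
    N : ℕ
    N = n ℕ.* (suc M ℕ.* suc M)

  √-approx≤ : ∀ n .{{_ : NonZero n}} M → √-approx n M ≤ fromℕℚ n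
  √-approx≤ n M = *-1/suc-≤ (fromℕℚ ⌊√ N ⌋) M (subst (fromℕℚ ⌊√ N ⌋ ≤_) (fromℕℚ-* n (suc M))
    (fromℕℚ-mono (square-cancel-≤ ⌊√ N ⌋ (n ℕ.* suc M) (ℕ.≤-trans (⌊√⌋-lower N)
      (subst (N ℕ.≤_) (solve 2 (λ n k → n :* (n :* (k :* k)) := n :* k :* (n :* k)) refl n (suc M))
        (ℕ.m≤n*m N n))))))
    where
    open ℕ-Solver
    N : ℕ
    N = n ℕ.* (suc M ℕ.* suc M)

  -- The divisor `suc i` contributes `F / suc i + 1` pairs, at most `x / suc i + 1`.
  length-quotientPairs : ∀ F m x → fromℕℚ F ≤ x →
    fromℕℚ (length (quotientPairs F m)) ≤ x * harmonicSum 0 m + fromℕℚ m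
  length-quotientPairs F zero    x F≤x =
    ℚ.≤-reflexive (sym (trans (ℚ.+-identityʳ (x * 0ℚ)) (ℚ.*-zeroʳ x)))
  length-quotientPairs F (suc i) x F≤x = begin
    fromℕℚ (length (quotientPairs F (suc i)))
      ≡⟨ cong fromℕℚ (trans (length-++ (map (i ,_) (upTo (suc q))))
           (cong (ℕ._+ length (quotientPairs F i)) (trans (length-map (i ,_) (upTo (suc q))) (length-upTo (suc q))))) ⟩
    fromℕℚ (1 ℕ.+ q ℕ.+ length (quotientPairs F i))
      ≡⟨ trans (fromℕℚ-+ (suc q) _) (cong (_+ ℓ) (fromℕℚ-+ 1 q)) ⟩
    1ℚ + fromℕℚ q + ℓ
      ≤⟨ ℚ.+-mono-≤ (ℚ.+-monoʳ-≤ 1ℚ q≤) (length-quotientPairs F i x F≤x) ⟩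
    1ℚ + x * 1/suc i + (x * harmonicSum 0 i + fromℕℚ i)
      ≡⟨ solve 4 (λ x r h i → con 1ℚ :+ x :* r :+ (x :* h :+ i) := x :* (h :+ r) :+ (con 1ℚ :+ i)) refl
           x (1/suc i) (harmonicSum 0 i) (fromℕℚ i) ⟩
    x * (harmonicSum 0 i + 1/suc i) + (1ℚ + fromℕℚ i)
      ≡⟨ cong (x * (harmonicSum 0 i + 1/suc i) +_) (fromℕℚ-+ 1 i) ⟨
    x * harmonicSum 0 (suc i) + fromℕℚ (suc i) ∎
    where
    open ℚ.≤-Reasoning
    open ℚ-Solver
    q : ℕ
    q = F ℕ./ suc i
    ℓ : ℚ
    ℓ = fromℕℚ (length (quotientPairs F i))
    q≤ : fromℕℚ q ≤ x * 1/suc i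
    q≤ = ≤-*-1/suc x i (ℚ.≤-trans (subst (_≤ fromℕℚ F) (fromℕℚ-* q (suc i)) (fromℕℚ-mono (m/n*n≤m F (suc i)))) F≤x)

  ≤-*-recip : ∀ {x y d} → 0ℚ < d → x * d ≤ y → x ≤ y * recip d
  ≤-*-recip {x} {y} {d} 0<d h = subst (_≤ y * recip d)
    (trans (ℚ.*-assoc x d (recip d)) (trans (cong (x *_) (recip-inverse 0<d)) (ℚ.*-identityʳ x)))
    (*-monoʳ (recip d) (ℚ.<⇒≤ (0<recip 0<d)) h)

  fromℕℚ-suc : ∀ i → fromℕℚ (suc i) ≡ 1ℚ + fromℕℚ i
  fromℕℚ-suc i = fromℕℚ-+ 1 i

  1≤fromℕℚ : ∀ n .{{_ : NonZero n}} → 1ℚ ≤ fromℕℚ n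
  1≤fromℕℚ n = fromℕℚ-mono (ℕ.>-nonZero⁻¹ n)

  -- Truncation costs nothing when the quotient vanishes, as then 4/5 alone is
  -- small enough.
  pred-quotient-≤ : ∀ n F .{{_ : NonZero n}} {A s x} → ℤ.+ 9 / 10 ≤ A → A * x ≡ s → s ≤ fromℕℚ n →
    0ℚ < fromℕℚ 2 * s - A → x < fromℕℚ (suc F) →
    fromℕℚ 2 * (fromℕℚ ((2 ℕ.* n ℕ.∸ 1) ℕ./ suc (2 ℕ.* F) ℕ.∸ 1) + ℤ.+ 4 / 5)
      ≤ (fromℕℚ 2 * (fromℕℚ 2 * fromℕℚ n - 1ℚ) * A) * recip (fromℕℚ 2 * s - A)
  pred-quotient-≤ n F {A} {x = x} 9/10≤A refl s≤n 0<D x<1+F =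
    -- Since `s` is `A * x`, the denominator is A(2x - 1), and 2x - 1 is less than 2F + 1.
    ≤-*-recip 0<D (by-cases ((2 ℕ.* n ℕ.∸ 1) ℕ./ suc (2 ℕ.* F)) (m/n*n≤m (2 ℕ.* n ℕ.∸ 1) (suc (2 ℕ.* F))))
    where
    open ℚ-Solver
    ν f : ℚ
    ν = fromℕℚ n
    f = fromℕℚ F
    0≤A : 0ℚ ≤ A
    0≤A = ℚ.≤-trans (from-yes (0ℚ ℚ.≤? ℤ.+ 9 / 10)) 9/10≤A
    0≤ν-1 : 0ℚ ≤ ν - 1ℚ
    0≤ν-1 = p≤q⇒0≤q-p (1≤fromℕℚ n)
    by-cases : ∀ g → g ℕ.* suc (2 ℕ.* F) ℕ.≤ 2 ℕ.* n ℕ.∸ 1 →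
      fromℕℚ 2 * (fromℕℚ (g ℕ.∸ 1) + ℤ.+ 4 / 5) * (fromℕℚ 2 * (A * x) - A) ≤ fromℕℚ 2 * (fromℕℚ 2 * ν - 1ℚ) * A
    by-cases zero _ = ≤-by-difference
      ((fromℕℚ 4 * (ν - 1ℚ) + ℤ.+ 18 / 5) * (A - ℤ.+ 9 / 10) + ℤ.+ 16 / 5 * (ν - A * x) + ℤ.+ 2 / 5 * (ν - 1ℚ) + ℤ.+ 1 / 25)
      (ℚ.+-mono-≤ (ℚ.+-mono-≤ (ℚ.+-mono-≤
        (0≤* (ℚ.+-mono-≤ (0≤* (0≤fromℕℚ 4) 0≤ν-1) (from-yes (0ℚ ℚ.≤? ℤ.+ 18 / 5))) (p≤q⇒0≤q-p 9/10≤A))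
        (0≤* (from-yes (0ℚ ℚ.≤? ℤ.+ 16 / 5)) (p≤q⇒0≤q-p s≤n)))
        (0≤* (from-yes (0ℚ ℚ.≤? ℤ.+ 2 / 5)) 0≤ν-1))
        (from-yes (0ℚ ℚ.≤? ℤ.+ 1 / 25)))
      (solve 3 (λ ν A x →
        con (fromℕℚ 2) :* (con 0ℚ :+ con (ℤ.+ 4 / 5)) :* (con (fromℕℚ 2) :* (A :* x) :- A)
        :+ ((con (fromℕℚ 4) :* (ν :- con 1ℚ) :+ con (ℤ.+ 18 / 5)) :* (A :- con (ℤ.+ 9 / 10))
          :+ con (ℤ.+ 16 / 5) :* (ν :- A :* x) :+ con (ℤ.+ 2 / 5) :* (ν :- con 1ℚ) :+ con (ℤ.+ 1 / 25))
        := con (fromℕℚ 2) :* (con (fromℕℚ 2) :* ν :- con 1ℚ) :* A) refl ν A x)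
    -- The first two slacks come from rounding the quotient and from `x < F + 1`. The third is what
    -- remains of the subtracted 1 after adding 4/5, namely 1/5, doubled and multiplied by the
    -- denominator.
    by-cases (suc g) h = ≤-by-difference
      (fromℕℚ 2 * A * (fromℕℚ 2 * ν - (1ℚ + (1ℚ + γ) * (1ℚ + fromℕℚ 2 * f)))
        + fromℕℚ 4 * ((1ℚ + γ) * A * (1ℚ + f - x)) + ℤ.+ 2 / 5 * (fromℕℚ 2 * (A * x) - A))
      (ℚ.+-mono-≤ (ℚ.+-mono-≤
        (0≤* (0≤* (0≤fromℕℚ 2) 0≤A) (p≤q⇒0≤q-p h′))
        (0≤* (0≤fromℕℚ 4) (0≤* (0≤* (subst (0ℚ ≤_) (fromℕℚ-suc g) (0≤fromℕℚ (suc g))) 0≤A)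
          (p≤q⇒0≤q-p (subst (x ≤_) (fromℕℚ-suc F) (ℚ.<⇒≤ x<1+F))))))
        (0≤* (from-yes (0ℚ ℚ.≤? ℤ.+ 2 / 5)) (ℚ.<⇒≤ 0<D)))
      (solve 5 (λ ν A x γ f →
        con (fromℕℚ 2) :* (γ :+ con (ℤ.+ 4 / 5)) :* (con (fromℕℚ 2) :* (A :* x) :- A)
        :+ (con (fromℕℚ 2) :* A :* (con (fromℕℚ 2) :* ν :- (con 1ℚ :+ (con 1ℚ :+ γ) :* (con 1ℚ :+ con (fromℕℚ 2) :* f)))
          :+ con (fromℕℚ 4) :* ((con 1ℚ :+ γ) :* A :* (con 1ℚ :+ f :- x))
          :+ con (ℤ.+ 2 / 5) :* (con (fromℕℚ 2) :* (A :* x) :- A))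
        := con (fromℕℚ 2) :* (con (fromℕℚ 2) :* ν :- con 1ℚ) :* A) refl ν A x γ f)
      where
      γ : ℚ
      γ = fromℕℚ g
      h′ : 1ℚ + (1ℚ + γ) * (1ℚ + fromℕℚ 2 * f) ≤ fromℕℚ 2 * ν
      h′ = subst₂ _≤_
        (trans (fromℕℚ-suc (suc g ℕ.* suc (2 ℕ.* F))) (cong (1ℚ +_)
          (trans (fromℕℚ-* (suc g) (suc (2 ℕ.* F))) (cong₂ _*_ (fromℕℚ-suc g)
            (trans (fromℕℚ-suc (2 ℕ.* F)) (cong (1ℚ +_) (fromℕℚ-* 2 F)))))))
        (fromℕℚ-* 2 n)
        (fromℕℚ-mono (subst (suc (suc g ℕ.* suc (2 ℕ.* F)) ℕ.≤_)
          (ℕ.m+[n∸m]≡n (ℕ.*-mono-≤ {1} {2} (s≤s z≤n) (ℕ.>-nonZero⁻¹ n))) (s≤s h)))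

  -- For m = p + 1 we have s/m ≤ 1 + s - m because (s - m)(m - 1) ≥ 0, and x ≤ (10/9) s because A ≥
  -- 9/10.
  s/m-≤ : ∀ {A s x p} → ℤ.+ 9 / 10 ≤ A → A * x ≡ s → 0ℚ ≤ x → fromℕℚ (suc p) ≤ s →
    x * 1/suc p ≤ ℤ.+ 10 / 9 * (1ℚ + s - fromℕℚ (suc p))
  s/m-≤ {A} {s} {x} {p} 9/10≤A refl 0≤x m≤s = *-1/suc-≤ x p (≤-by-difference
    (ℤ.+ 10 / 9 * ((A - ℤ.+ 9 / 10) * x) + ℤ.+ 10 / 9 * ((A * x - (1ℚ + μ)) * μ))
    (ℚ.+-mono-≤
      (0≤* (from-yes (0ℚ ℚ.≤? ℤ.+ 10 / 9)) (0≤* (p≤q⇒0≤q-p 9/10≤A) 0≤x))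
      (0≤* (from-yes (0ℚ ℚ.≤? ℤ.+ 10 / 9)) (0≤* (p≤q⇒0≤q-p (subst (_≤ A * x) (fromℕℚ-suc p) m≤s)) (0≤fromℕℚ p))))
    (trans (solve 3 (λ A x μ →
        x :+ (con (ℤ.+ 10 / 9) :* ((A :- con (ℤ.+ 9 / 10)) :* x) :+ con (ℤ.+ 10 / 9) :* ((A :* x :- (con 1ℚ :+ μ)) :* μ))
        := con (ℤ.+ 10 / 9) :* (con 1ℚ :+ A :* x :- (con 1ℚ :+ μ)) :* (con 1ℚ :+ μ)) refl A x μ)
      (cong (λ m → ℤ.+ 10 / 9 * (1ℚ + A * x - m) * m) (sym (fromℕℚ-suc p)))))
    where
    open ℚ-Solver
    μ : ℚ
    μ = fromℕℚ p

  -- The theorem at stage `M` of the approximations, with `A` for α; the right side has the shape of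
  -- the `M`-th term of the real bound. The margin 2/5 does not depend on `M`, which yields a strict
  -- inequality between reals.
  upper-bound : ∀ a b .{{_ : NonZero a}} .{{_ : NonZero b}} .{{_ : NonZero (a ℕ.* b)}} M → 79 ℕ.≤ M →
    ∀ A → let s = √-approx (a ℕ.* b) M in ℤ.+ 9 / 10 ≤ A → A ≤ s + ½ →
    fromℕℚ (ρ′ a b) + ℤ.+ 2 / 5 ≤
      1ℚ * recip A * s * log-approx (a ℕ.* b) M
      + fromℕℚ 2 * (1ℚ + ℤ.+ 6 / 10 * recip A) * s
      + (fromℕℚ 2 * (fromℕℚ 2 * fromℕℚ (a ℕ.* b) - 1ℚ) * A) * recip (fromℕℚ 2 * s - A)
  upper-bound a b M 79≤M A 9/10≤A A≤s+½ =
    with-floor (floor x (suc (2 ℕ.* n)) 0≤x x<)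
    where
    open ℚ-Solver
    n m p : ℕ
    n = a ℕ.* b
    m = ⌊√ n ⌋
    p = ℕ.pred m
    s x L K : ℚ
    s = √-approx n M
    x = recip A * s
    L = log-approx n M
    K = (fromℕℚ 2 * (fromℕℚ 2 * fromℕℚ n - 1ℚ) * A) * recip (fromℕℚ 2 * s - A)
    m≡ : suc p ≡ m
    m≡ = ℕ.suc-pred m {{ℕ.>-nonZero (⌊√⌋-greatest 1 n (ℕ.>-nonZero⁻¹ n))}}
    0<A : 0ℚ < A
    0<A = ℚ.<-≤-trans (from-yes (0ℚ ℚ.<? ℤ.+ 9 / 10)) 9/10≤A
    1≤s : 1ℚ ≤ s
    1≤s = 1≤√-approx n M
    0≤x : 0ℚ ≤ x
    0≤x = 0≤* (ℚ.<⇒≤ (0<recip 0<A)) (ℚ.≤-trans (from-yes (0ℚ ℚ.≤? 1ℚ)) 1≤s)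
    Ax≡s : A * x ≡ s
    Ax≡s = trans (sym (ℚ.*-assoc A (recip A) s)) (trans (cong (_* s) (recip-inverse 0<A)) (ℚ.*-identityˡ s))
    s≤n : s ≤ fromℕℚ n
    s≤n = √-approx≤ n M
    m≤s : fromℕℚ (suc p) ≤ s
    m≤s = subst (λ m → fromℕℚ m ≤ s) (sym m≡) (⌊√⌋≤√-approx n M)
    0<D : 0ℚ < fromℕℚ 2 * s - A
    0<D = ℚ.<-≤-trans 0<½ (≤-by-difference ((s - 1ℚ) + (s + ½ - A))
      (ℚ.+-mono-≤ (p≤q⇒0≤q-p 1≤s) (p≤q⇒0≤q-p A≤s+½))
      (solve 2 (λ s A → con ½ :+ ((s :- con 1ℚ) :+ (s :+ con ½ :- A)) := con (fromℕℚ 2) :* s :- A) refl s A))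
    -- A crude bound, serving only as the start of the search in `floor`.
    x< : x < fromℕℚ (suc (2 ℕ.* n))
    x< = ℚ.≤-<-trans (≤-by-difference
        (ℤ.+ 10 / 9 * ((A - ℤ.+ 9 / 10) * x) + ℤ.+ 8 / 9 * A * x + fromℕℚ 2 * (fromℕℚ n - A * x))
        (ℚ.+-mono-≤ (ℚ.+-mono-≤
          (0≤* (from-yes (0ℚ ℚ.≤? ℤ.+ 10 / 9)) (0≤* (p≤q⇒0≤q-p 9/10≤A) 0≤x))
          (0≤* (0≤* (from-yes (0ℚ ℚ.≤? ℤ.+ 8 / 9)) (ℚ.<⇒≤ 0<A)) 0≤x))
          (0≤* (0≤fromℕℚ 2) (p≤q⇒0≤q-p (subst (_≤ fromℕℚ n) (sym Ax≡s) s≤n))))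
        (trans (solve 3 (λ A x ν → x :+ (con (ℤ.+ 10 / 9) :* ((A :- con (ℤ.+ 9 / 10)) :* x) :+ con (ℤ.+ 8 / 9) :* A :* x
            :+ con (fromℕℚ 2) :* (ν :- A :* x)) := con (fromℕℚ 2) :* ν) refl A x (fromℕℚ n))
          (sym (fromℕℚ-* 2 n))))
      (subst₂ _<_ (ℚ.+-identityˡ _) (sym (fromℕℚ-suc (2 ℕ.* n)))
        (ℚ.+-monoˡ-< (fromℕℚ (2 ℕ.* n)) (from-yes (0ℚ ℚ.<? 1ℚ))))
    with-floor : (∃ λ F → fromℕℚ F ≤ x × x < fromℕℚ (suc F)) → _
    -- Each summand but the last is the slack of one estimate. The 8/5 gained in `pred-quotient-≤`
    -- pays for the 10/9 from `s/m-≤` and the margin 2/5, and 4/45 is left over.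
    with-floor (F , F≤x , x<1+F) = ≤-by-difference
      ((fromℕℚ 2 * g + fromℕℚ 2 * ℓ - ρ)
        + (K - fromℕℚ 2 * (g + ℤ.+ 4 / 5))
        + fromℕℚ 2 * (x * h + μ - ℓ)
        + fromℕℚ 2 * (x * (½ * L + ⅗ + ½ * r - h))
        + (ℤ.+ 10 / 9 * (1ℚ + s - μ) - x * r)
        + ℤ.+ 8 / 9 * (s - μ) + ℤ.+ 4 / 45)
      (ℚ.+-mono-≤ (ℚ.+-mono-≤ (ℚ.+-mono-≤ (ℚ.+-mono-≤ (ℚ.+-mono-≤ (ℚ.+-mono-≤
        (p≤q⇒0≤q-p ρ≤)
        (p≤q⇒0≤q-p (pred-quotient-≤ n F 9/10≤A Ax≡s s≤n 0<D x<1+F)))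
        (0≤* (0≤fromℕℚ 2) (p≤q⇒0≤q-p ℓ≤)))
        (0≤* (0≤fromℕℚ 2) (0≤* 0≤x (p≤q⇒0≤q-p (harmonicSum-≤-log n p M p²≤n 79≤M)))))
        (p≤q⇒0≤q-p (s/m-≤ {p = p} 9/10≤A Ax≡s 0≤x m≤s)))
        (0≤* (from-yes (0ℚ ℚ.≤? ℤ.+ 8 / 9)) (p≤q⇒0≤q-p m≤s)))
        (from-yes (0ℚ ℚ.≤? ℤ.+ 4 / 45)))
      (identity ρ g ℓ K h μ L r s (recip A))
      where
      g′ ℓ′ : ℕ
      g′ = (2 ℕ.* n ℕ.∸ 1) ℕ./ suc (2 ℕ.* F) ℕ.∸ 1
      ℓ′ = length (quotientPairs F m)
      ρ g ℓ h μ r : ℚ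
      ρ = fromℕℚ (ρ′ a b)
      g = fromℕℚ g′
      ℓ = fromℕℚ ℓ′
      h = harmonicSum 0 (suc p)
      μ = fromℕℚ (suc p)
      r = 1/suc p
      p²≤n : suc p ℕ.* suc p ℕ.≤ n
      p²≤n = subst (λ m → m ℕ.* m ℕ.≤ n) (sym m≡) (⌊√⌋-lower n)
      ℓ≤ : ℓ ≤ x * h + μ
      ℓ≤ = subst (λ m′ → ℓ ≤ x * harmonicSum 0 m′ + fromℕℚ m′) (sym m≡) (length-quotientPairs F m x F≤x)
      ρ≤ : ρ ≤ fromℕℚ 2 * g + fromℕℚ 2 * ℓ
      ρ≤ = subst (ρ ≤_)
        (trans (fromℕℚ-+ (2 ℕ.* g′) (2 ℕ.* ℓ′)) (cong₂ _+_ (fromℕℚ-* 2 g′) (fromℕℚ-* 2 ℓ′)))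
        (fromℕℚ-mono {ρ′ a b} {2 ℕ.* g′ ℕ.+ 2 ℕ.* ℓ′} (ρ′-≤ F))
      identity : ∀ ρ g ℓ K h μ L r s A⁻¹ → let x = A⁻¹ * s in
        ρ + ℤ.+ 2 / 5 + ((fromℕℚ 2 * g + fromℕℚ 2 * ℓ - ρ)
          + (K - fromℕℚ 2 * (g + ℤ.+ 4 / 5))
          + fromℕℚ 2 * (x * h + μ - ℓ)
          + fromℕℚ 2 * (x * (½ * L + ⅗ + ½ * r - h))
          + (ℤ.+ 10 / 9 * (1ℚ + s - μ) - x * r)
          + ℤ.+ 8 / 9 * (s - μ) + ℤ.+ 4 / 45)
        ≡ 1ℚ * A⁻¹ * s * L + fromℕℚ 2 * (1ℚ + ℤ.+ 6 / 10 * A⁻¹) * s + K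
      identity = solve 10 (λ ρ g ℓ K h μ L r s A⁻¹ → let x = A⁻¹ :* s in
        ρ :+ con (ℤ.+ 2 / 5) :+ ((con (fromℕℚ 2) :* g :+ con (fromℕℚ 2) :* ℓ :- ρ)
          :+ (K :- con (fromℕℚ 2) :* (g :+ con (ℤ.+ 4 / 5)))
          :+ con (fromℕℚ 2) :* (x :* h :+ μ :- ℓ)
          :+ con (fromℕℚ 2) :* (x :* (con ½ :* L :+ con ⅗ :+ con ½ :* r :- h))
          :+ (con (ℤ.+ 10 / 9) :* (con 1ℚ :+ s :- μ) :- x :* r)
          :+ con (ℤ.+ 8 / 9) :* (s :- μ) :+ con (ℤ.+ 4 / 45))
        := con 1ℚ :* A⁻¹ :* s :* L :+ con (fromℕℚ 2) :* (con 1ℚ :+ con (ℤ.+ 6 / 10) :* A⁻¹) :* s :+ K) refl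

-- Passage to real numbers.

open import Data.Integer.Base using (+_)
open import Defs

theorem1 : (a b n : ℕ) .{{_ : NonZero a}} .{{_ : NonZero b}} .{{_ : NonZero n}} → n ≡ a ℕ.* b →
    (α : ℝ) (1≤α : fromℕ 1 ≤ α) (α≤√n : α ≤ √ n) →
    fromℕ (ρ′ a b) <
    (fromℕ 1 ÷ α [ 1≤⇒0< α 1≤α ]) * √ n * log n
    + fromℕ 2 * (fromℕ 1 + fromℚ (+ 6 / 10) ÷ α [ 1≤⇒0< α 1≤α ]) * √ n
    + (fromℕ 2 * (fromℕ 2 * fromℕ n - fromℕ 1) * α) ÷ (fromℕ 2 * √ n - α) [ ≤√⇒0<2√- α n α≤√n ]
theorem1 a b _ refl α 1≤α α≤√n =
  -- The hypotheses on α are used with errors 1/10 and 1/2, so that eventually its approximations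
  -- are at least 9/10 and exceed those of √n by at most 1/2.
  + 2 / 5 , from-yes (0ℚ ℚ.<? + 2 / 5) , (I ℕ.⊔ J) ℕ.⊔ 79 , λ M hM →
    let hIJ = ℕ.m⊔n≤o⇒m≤o (I ℕ.⊔ J) 79 hM in
    Estimates.upper-bound a b M (ℕ.m⊔n≤o⇒n≤o (I ℕ.⊔ J) 79 hM) (seq α M)
      (ℚ-Lemmas.+-cancelˡ-≤ (+ 1 / 10) (subst (1ℚ ℚ.≤_) (ℚ.+-comm (seq α M) (+ 1 / 10))
        (proj₂ eventually-1≤ M (ℕ.m⊔n≤o⇒m≤o I J hIJ))))
      (proj₂ eventually-≤√ M (ℕ.m⊔n≤o⇒n≤o I J hIJ))
  where
  eventually-1≤ : Eventually (λ M → 1ℚ ℚ.≤ seq α M ℚ.+ + 1 / 10)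
  eventually-1≤ = 1≤α (+ 1 / 10) (from-yes (0ℚ ℚ.<? + 1 / 10))
  eventually-≤√ : Eventually (λ M → seq α M ℚ.≤ √-approx (a ℕ.* b) M ℚ.+ ½)
  eventually-≤√ = α≤√n ½ ℚ-Lemmas.0<½
  I J : ℕ
  I = proj₁ eventually-1≤
  J = proj₁ eventually-≤√
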